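{- The TriOrMultiSSR (Search) Problem can be solved in polynomial time: there is an oracle algorithm that, given an instance of TriOrMultiSSR, decides in polynomial time whether a solution exists and, if so, finds one.
   Context: $\mathbb N=\{0,1,2,\dots\}$. A (finite) multiset in a universe $\mathcal U$ is a function $\mathsf L:\mathcal U\to\mathbb N$ of finite support; it contains $u$ if $\mathsf L(u)>0$. It is represented by listing its support and the multiplicities, so the length of the representation is $|\operatorname{supp}(\mathsf L)|\cdot\log\|\mathsf L\|_\infty\cdot\ell$, where $\ell$ is the description length of elements. TriOrMultiSSR (Triangular Oracle Multi-dimensional Subset Sum with Repetition). Elements of two sets $\mathcal U$ and $\mathcal V$ are encoded, possibly non-uniquely, by strings in $\Sigma_1^{n_1}$ and $\Sigma_2^{n_2}$ respectively. Explicit input: the alphabets $\Sigma_1,\Sigma_2$; the numbers $n_1,n_2$ in unary; and a multiset $\mathsf K:\mathcal U\to\mathbb N$, given by its support (encoded) and multiplicities. There is a family $\mathfrak F=\{\mathsf F_v\}_{v\in\mathcal V}$ of multisets $\mathsf F_v:\mathcal U\to\mathbb N$. Triangular Condition: $\mathcal U$ has a total preorder $\preccurlyeq$ (reflexive, transitive, any two elements comparable); for every $v\in\mathcal V$ the multiset $\mathsf F_v$ contains a unique $\preccurlyeq$-minimal element $\tau(v)\in\mathcal U$; and the map $\tau:\mathcal V\to\mathcal U$ is injective. Oracles: $\equiv$, deciding whether two strings encode the same element of $\mathcal U$ (or of $\mathcal V$); the $\mathfrak F$-oracle, returning $\mathsf F_v$ on input (any encoding of) $v\in\mathcal V$; $\preccurlyeq$,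 comparing two elements of $\mathcal U$; and $\triangle:\mathcal U\to\mathcal V\cup\{\mathrm{Error}\}$, returning on input $u$ the unique $v$ with $\tau(v)=u$ if it exists and Error otherwise. Solution: a multiset $\mathsf L:\mathcal V\to\mathbb N$ with $\sum_{v\in\mathcal V}\mathsf L(v)\cdot\mathsf F_v=\mathsf K$. Polynomial time means polynomial in the length of the input (in particular of $\mathsf K$) and the length of the representations of the elements of $\mathfrak F$, where oracle calls count as unit cost. -}

module Defs where

open import Level using (0ℓ)
open import Data.Bool.Base using (Bool; true; false; if_then_else_)
open import Data.Fin.Base using (Fin; zero; toℕ)
open import Data.List.Base using (List; []; _∷_; map; sum; foldr; allFin; replicate)
open import Data.List.Membership.Propositional using (_∈_)
open import Data.List.Relation.Binary.Permutation.Propositional using (_↭_)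
open import Data.List.Relation.Binary.Pointwise.Base using (Pointwise)
open import Data.List.Relation.Unary.Unique.Propositional using (Unique)
open import Data.Maybe.Base using (Maybe; just; nothing)
open import Data.Nat.Base using (ℕ; zero; suc; _+_; _*_; _∸_; _≤_; _<_; _/_; _≤ᵇ_)
open import Data.Nat.Logarithm using (⌊log₂_⌋)
open import Data.Product.Base using (Σ; ∃; ∃-syntax; _×_; _,_; proj₁; proj₂)
open import Data.Sum.Base using (_⊎_)
open import Data.Vec.Base as Vec using (Vec; _∷_; lookup; _[_]≔_)
open import Function.Bundles using (_⇔_)
open import Relation.Binary.Core using (Rel)
open import Relation.Binary.PropositionalEquality.Core using (_≡_)
open import Relation.Binary.Structures using (IsTotalPreorder)
open import Relation.Nullary.Decidable.Core using (Dec; does)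
open import Relation.Nullary.Negation.Core using (¬_)

------------------------------------------------------------------------
-- Multisets

-- `support` enumerates, without repetition, exactly the elements of
-- positive multiplicity; the order of the enumeration carries no meaning.
record Multiset (A : Set) : Set where
  field
    mult           : A → ℕ
    support        : List A
    support-unique : Unique support
    support-exact  : ∀ a → a ∈ support ⇔ 0 < mult a

open Multiset public

_contains_ : {A : Set} → Multiset A → A → Set
L contains a = 0 < mult L a

------------------------------------------------------------------------
-- Encodings by strings

Str : ℕ → ℕ → Set
Str k n = Vec (Fin k) n

-- A string need not encode anything, an element may have several encodings,
-- but every element has at least one.
record Encoding (A : Set) (k n : ℕ) : Set where
  field
    decode    : Str k n → Maybe A
    encodable : ∀ a → ∃[ s ] decode s ≡ just a

  Encodes : Str k n → A → Set
  Encodes s a = decode s ≡ just a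

  SameElement : Str k n → Str k n → Set
  SameElement s t = ∃[ a ] Encodes s a × Encodes t a

open Encoding public

MultisetRepr : ℕ → ℕ → Set
MultisetRepr k n = List (Str k n × ℕ)

-- Each element of the support is listed exactly once, in any order and by
-- any one of its encodings, together with its multiplicity.
Represents : {A : Set} {k n : ℕ} → Encoding A k n → MultisetRepr k n → Multiset A → Set
Represents E r L =
  ∃[ as ] Pointwise (λ e a → Encodes E (proj₁ e) a × proj₂ e ≡ mult L a) r as
        × as ↭ support L

------------------------------------------------------------------------
-- Instances

record Instance : Set₁ where
  infix 4 _≼_
  field
    U V         : Set
    k₁ n₁ k₂ n₂ : ℕ
    encU        : Encoding U k₁ n₁
    encV        : Encoding V k₂ n₂

    K           : Multiset U
    K-repr      : MultisetRepr k₁ n₁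
    K-repr-ok   : Represents encU K-repr K

    F           : V → Multiset U

    _≼_             : Rel U 0ℓ
    isTotalPreorder : IsTotalPreorder _≡_ _≼_

  MinimalIn : Multiset U → U → Set
  MinimalIn L u = L contains u × (∀ w → L contains w → w ≼ u → u ≼ w)

  field
    τ           : V → U
    τ-minimal   : ∀ v → MinimalIn (F v) (τ v)
    τ-unique    : ∀ v u → MinimalIn (F v) u → u ≡ τ v
    τ-injective : ∀ v w → τ v ≡ τ w → v ≡ w

  IsSolution : Multiset V → Set
  IsSolution L =
    ∀ u → sum (map (λ v → mult L v * mult (F v) u) (support L)) ≡ mult K u

------------------------------------------------------------------------
-- The machine model: WHILE programs over binary trees with natural numbers
-- at the leaves, run with oracles.

data Val : Set where
  nil  : Val
  num  : ℕ → Val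
  cons : Val → Val → Val

-- Numbers are written in binary.
size : Val → ℕ
size nil        = 1
size (num n)    = suc ⌊log₂ n ⌋
size (cons x y) = suc (size x + size y)

bool : Bool → Val
bool false = nil
bool true  = cons nil nil

truthy : Val → Bool
truthy nil        = false
truthy (num _)    = true
truthy (cons _ _) = true

data Op : Set where
  add sub mul quo leq : Op

data Query : Set where
  equalU equalV family compare triangle : Query

Oracle : Set
Oracle = Query → Val → Val

data Expr (m : ℕ) : Set where
  var   : Fin m → Expr m
  nil   : Expr m
  num   : ℕ → Expr m
  cons  : Expr m → Expr m → Expr m
  hd tl : Expr m → Expr m
  op    : Op → Expr m → Expr m → Expr m

infix  6 _:=_ _:=ask_⟨_⟩
infixr 5 _⨟_

data Cmd (m : ℕ) : Set where
  skip    : Cmd m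
  _:=_    : Fin m → Expr m → Cmd m
  _:=ask_⟨_⟩ : Fin m → Query → Expr m → Cmd m
  _⨟_     : Cmd m → Cmd m → Cmd m
  cond    : Expr m → Cmd m → Cmd m → Cmd m
  while   : Expr m → Cmd m → Cmd m

Store : ℕ → Set
Store = Vec Val

-- Ill-typed operands give junk values rather than errors.
head′ tail′ : Val → Val
head′ (cons x _) = x
head′ _          = nil
tail′ (cons _ y) = y
tail′ _          = nil

quotient : ℕ → ℕ → ℕ
quotient a zero    = 0
quotient a (suc b) = a / suc b

applyℕ : Op → ℕ → ℕ → Val
applyℕ add a b = num (a + b)
applyℕ sub a b = num (a ∸ b)
applyℕ mul a b = num (a * b)
applyℕ quo a b = num (quotient a b)
applyℕ leq a b = bool (a ≤ᵇ b)

apply : Op → Val → Val → Val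
apply o (num a) (num b) = applyℕ o a b
apply o _       _       = nil

eval : {m : ℕ} → Store m → Expr m → Val
eval σ (var x)    = lookup σ x
eval σ nil        = nil
eval σ (num n)    = num n
eval σ (cons e f) = cons (eval σ e) (eval σ f)
eval σ (hd e)     = head′ (eval σ e)
eval σ (tl e)     = tail′ (eval σ e)
eval σ (op o e f) = apply o (eval σ e) (eval σ f)

-- Evaluating an expression costs the total size of the values of all its
-- subexpressions.  In particular copying is not free, and arithmetic is charged
-- by the bit length of the operands and the result (logarithmic cost), so this
-- time measure is polynomially related to that of oracle Turing machines.
cost : {m : ℕ} → Store m → Expr m → ℕ
subcosts : {m : ℕ} → Store m → Expr m → ℕ
cost σ e = size (eval σ e) + subcosts σ e
subcosts σ (var x)    = 0
subcosts σ nil        = 0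
subcosts σ (num n)    = 0
subcosts σ (cons e f) = cost σ e + cost σ f
subcosts σ (hd e)     = cost σ e
subcosts σ (tl e)     = cost σ e
subcosts σ (op o e f) = cost σ e + cost σ f

-- O ⊢ c , σ ⇓ σ′ [ t ]: with oracle O, command c started in store σ halts
-- in store σ′ after time t.  Beyond the evaluation of the query string, an
-- oracle call takes one step.
infix 3 _⊢_,_⇓_[_]

data _⊢_,_⇓_[_] {m : ℕ} (O : Oracle) : Cmd m → Store m → Store m → ℕ → Set where
  ⇓skip   : ∀ {σ} → O ⊢ skip , σ ⇓ σ [ 1 ]
  ⇓assign : ∀ {σ x e} → O ⊢ x := e , σ ⇓ σ [ x ]≔ eval σ e [ 1 + cost σ e ]
  ⇓ask    : ∀ {σ x q e} →
            O ⊢ x :=ask q ⟨ e ⟩ , σ ⇓ σ [ x ]≔ O q (eval σ e) [ 1 + cost σ e ]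
  ⇓seq    : ∀ {σ σ′ σ″ c d s t} →
            O ⊢ c , σ ⇓ σ′ [ s ] → O ⊢ d , σ′ ⇓ σ″ [ t ] →
            O ⊢ c ⨟ d , σ ⇓ σ″ [ s + t ]
  ⇓cond   : ∀ {σ σ′ e c d t} →
            O ⊢ (if truthy (eval σ e) then c else d) , σ ⇓ σ′ [ t ] →
            O ⊢ cond e c d , σ ⇓ σ′ [ 1 + cost σ e + t ]
  ⇓stop   : ∀ {σ e c} → truthy (eval σ e) ≡ false →
            O ⊢ while e c , σ ⇓ σ [ 1 + cost σ e ]
  ⇓loop   : ∀ {σ σ′ σ″ e c s t} → truthy (eval σ e) ≡ true →
            O ⊢ c , σ ⇓ σ′ [ s ] → O ⊢ while e c , σ′ ⇓ σ″ [ t ] →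
            O ⊢ while e c , σ ⇓ σ″ [ 1 + cost σ e + s + t ]

-- Register 0 holds the input at the start and the output at the end.
record Program : Set where
  field
    auxiliary : ℕ
    body      : Cmd (suc auxiliary)

HaltsWith : Oracle → Program → Val → Val → ℕ → Set
HaltsWith O P x y t =
  ∃[ σ ] (O ⊢ body , x ∷ Vec.replicate auxiliary nil ⇓ σ [ t ]) × Vec.head σ ≡ y
  where open Program P

------------------------------------------------------------------------
-- Data as seen by the machine

listVal : {A : Set} → (A → Val) → List A → Val
listVal f = foldr (λ a → cons (f a)) nil

letterVal : {k : ℕ} → Fin k → Val
letterVal i = num (toℕ i)

strVal : {k n : ℕ} → Str k n → Val
strVal s = listVal letterVal (Vec.toList s)

reprVal : {k n : ℕ} → MultisetRepr k n → Val
reprVal = listVal (λ e → cons (strVal (proj₁ e)) (num (proj₂ e)))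

maybeVal : {A : Set} → (A → Val) → Maybe A → Val
maybeVal f nothing  = nil
maybeVal f (just a) = cons (f a) nil

alphabetVal : ℕ → Val
alphabetVal k = listVal letterVal (allFin k)

unaryVal : ℕ → Val
unaryVal n = listVal (λ x → x) (replicate n nil)

module _ (I : Instance) where
  open Instance I

  inputVal : Val
  inputVal = listVal (λ x → x)
    (alphabetVal k₁ ∷ alphabetVal k₂ ∷ unaryVal n₁ ∷ unaryVal n₂ ∷ reprVal K-repr ∷ [])

  -- Nothing is assumed about answers to other queries than these.
  record Answers (O : Oracle) : Set where
    field
      equalU-ok   : ∀ s t → Σ (Dec (SameElement encU s t)) λ d →
                    O equalU (cons (strVal s) (strVal t)) ≡ bool (does d)
      equalV-ok   : ∀ s t → Σ (Dec (SameElement encV s t)) λ d →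
                    O equalV (cons (strVal s) (strVal t)) ≡ bool (does d)
      family-ok   : ∀ s v → Encodes encV s v →
                    ∃[ r ] O family (strVal s) ≡ reprVal r × Represents encU r (F v)
      compare-ok  : ∀ s t u w → Encodes encU s u → Encodes encU t w →
                    Σ (Dec (u ≼ w)) λ d →
                    O compare (cons (strVal s) (strVal t)) ≡ bool (does d)
      -- `nothing` is Error
      triangle-ok : ∀ s u → Encodes encU s u →
                    (∃[ t ] ∃[ v ] O triangle (strVal s) ≡ maybeVal (strVal {k₂} {n₂}) (just t)
                                 × Encodes encV t v × τ v ≡ u)
                    ⊎ (O triangle (strVal s) ≡ maybeVal (strVal {k₂} {n₂}) nothing
                       × ¬ (∃[ v ] τ v ≡ u))

  -- M bounds the length of every representation of a member of the family.
  FamilyLength≤ : Oracle → ℕ → Set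
  FamilyLength≤ O M = ∀ s v → Encodes encV s v → size (O family (strVal s)) ≤ M

  CorrectOutput : Val → Set
  CorrectOutput y =
      (∃[ r ] ∃[ L ] y ≡ maybeVal reprVal (just r) × Represents encV r L × IsSolution L)
    ⊎ (y ≡ maybeVal (reprVal {k₂} {n₂}) nothing × ¬ (∃[ L ] IsSolution L))

{-# OPTIONS --safe #-}

-- Let u be a minimal element of the multiset K still to be covered. If a solution
-- exists, some v of positive coefficient has u in F v; then τ v lies in K and below u,
-- so τ v = u, and v is the only element of the solution whose multiset contains u.
-- Hence v is the answer of the triangle oracle, its coefficient is forced to be
-- K(u) / F v (u), and subtracting that multiple of F v removes u from the support of K.
-- There are thus at most |supp K| rounds, in which multiplicities only decrease.
--
-- For the running time it suffices to bound the number of elementary steps and the size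
-- of the registers, because the cost of evaluating an expression is linear in the latter.
module Submission where

open import Defs
open import Data.Bool.Base using (Bool; true; false; T; if_then_else_)
open import Data.Bool.Properties using (T-≡)
open import Data.Fin.Base using (Fin; zero; suc)
open import Data.Fin.Patterns using (0F; 1F; 2F; 3F; 4F; 5F; 6F; 7F; 8F; 9F)
open import Data.List.Base using (List; []; _∷_; map; length; replicate; _++_)
open import Data.List.Membership.Propositional using (_∈_)
open import Data.List.Membership.Propositional.Properties using (∈-∃++; ∈-allFin)
open import Data.List.Properties using (map-∘; map-cong-local; length-replicate)
open import Data.List.Relation.Binary.Permutation.Propositional using (_↭_; ↭-refl; ↭-sym; ↭⇒↭ₛ)
open import Data.List.Relation.Binary.Permutation.Propositional.Properties using (shift; map⁺; ∈-resp-↭)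
import Data.List.Relation.Binary.Permutation.Setoid.Properties as SetoidPerm
open import Data.List.Relation.Binary.Pointwise.Base using (Pointwise; []; _∷_)
open import Data.List.Relation.Unary.All as All using (All; []; _∷_)
import Data.List.Relation.Unary.All.Properties as All
open import Data.List.Relation.Unary.AllPairs using ([]; _∷_)
open import Data.List.Relation.Unary.Any using (Any; here; there)
open import Data.List.Relation.Unary.Unique.Propositional using (Unique)
open import Data.Maybe.Properties using (just-injective)
open import Data.Nat.Base hiding (compare)
open import Data.Nat.DivMod using (m/n≤m; m*n/n≡m)
open import Data.Nat.Induction using (<-rec)
open import Data.Nat.ListAction using (sum)
open import Data.Nat.ListAction.Properties using (sum-↭)
open import Data.Nat.Logarithm
open import Data.Nat.Properties
open import Data.Product.Base using (∃-syntax; _×_; _,_; proj₁; proj₂)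
open import Data.Sum.Base using (inj₁; inj₂)
open import Data.Vec.Base using ([]; _∷_; lookup; _[_]≔_)
open import Data.Vec.Relation.Unary.All as VAll using ([]; _∷_)
open import Data.Vec.Relation.Unary.All.Properties using (lookup⁺)
open import Function.Base using (id)
open import Function.Bundles using (mk⇔; Equivalence)
open import Relation.Binary.Definitions using (DecidableEquality)
open import Relation.Binary.PropositionalEquality
open import Relation.Binary.Structures using (IsTotalPreorder)
open import Relation.Nullary using (Dec; does; ¬_; yes; no; contradiction)
-- Polynomial bounds

-- Three obstacles shape the details. Subtraction on naturals truncates, so a round subtracts only
-- after testing that the quotient is exact at u and that the multiple of F v lies pointwise below
-- the residual. A solution forces both tests to succeed; hence a failed test, like the answer
-- Error, refutes solvability. Correctness thus rests on two invariants: solvability of K passes to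
-- the residual, which justifies a negative answer, and residual plus what was spent equals K, which
-- justifies a positive one. Products may outgrow every register. They are therefore never stored:
-- they occur only inside comparisons and as subtrahends, and each stored coefficient is a quotient,
-- no larger than the multiplicity it came from. Encodings are not unique, so a multiplicity is
-- looked up by scanning a whole list with the equality oracle.

PolyBounded : (ℕ → ℕ) → Set
PolyBounded f = ∃[ c ] ∃[ d ] (∀ n → f n ≤ c * suc n ^ d)

const-poly : ∀ k → PolyBounded (λ _ → k)
const-poly k = k , 0 , λ n → ≤-reflexive (sym (*-identityʳ k))

id-poly : PolyBounded (λ n → n)
id-poly = 1 , 1 , λ n → ≤-trans (n≤1+n n) (≤-reflexive (sym (trans (*-identityˡ _) (*-identityʳ (suc n)))))

-- Raising both exponents to `d + d′` is harmless because the base `suc n` is positive; with base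
-- `n` this would break at 0.
+-poly : ∀ {f g} → PolyBounded f → PolyBounded g → PolyBounded (λ n → f n + g n)
+-poly (c , d , p) (c′ , d′ , q) = c + c′ , d + d′ , λ n →
  ≤-trans (+-mono-≤ (≤-trans (p n) (*-monoʳ-≤ c (^-monoʳ-≤ (suc n) (m≤m+n d d′))))
                    (≤-trans (q n) (*-monoʳ-≤ c′ (^-monoʳ-≤ (suc n) (m≤n+m d′ d)))))
          (≤-reflexive (sym (*-distribʳ-+ (suc n ^ (d + d′)) c c′)))

*-poly : ∀ {f g} → PolyBounded f → PolyBounded g → PolyBounded (λ n → f n * g n)
*-poly (c , d , p) (c′ , d′ , q) = c * c′ , d + d′ , λ n →
  ≤-trans (*-mono-≤ (p n) (q n))
          (≤-reflexive (trans ([m*n]*[o*p]≡[m*o]*[n*p] c (suc n ^ d) c′ (suc n ^ d′))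
                              (cong (c * c′ *_) (sym (^-distribˡ-+-* (suc n) d d′)))))

[1+n]^d≤2^d*n^d : ∀ d {n} → 1 ≤ n → suc n ^ d ≤ 2 ^ d * n ^ d
[1+n]^d≤2^d*n^d zero    1≤n = ≤-refl
[1+n]^d≤2^d*n^d (suc d) {n} 1≤n =
  ≤-trans (*-mono-≤ (+-mono-≤ 1≤n (≤-reflexive (sym (+-identityʳ n)))) ([1+n]^d≤2^d*n^d d 1≤n))
          (≤-reflexive ([m*n]*[o*p]≡[m*o]*[n*p] 2 n (2 ^ d) (n ^ d)))

-- Returns to the base `n` of the theorem, at the price of a factor `2 ^ d`, since 1 + n ≤ 2n for
-- positive n.
poly-monomial : ∀ {f} → PolyBounded f → ∃[ c ] ∃[ d ] (∀ n → 1 ≤ n → f n ≤ c * n ^ d + c)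
poly-monomial (c , d , p) = c * 2 ^ d , d , λ n 1≤n →
  ≤-trans (p n) (≤-trans (*-monoʳ-≤ c ([1+n]^d≤2^d*n^d d 1≤n))
          (≤-trans (≤-reflexive (sym (*-assoc c (2 ^ d) (n ^ d)))) (m≤m+n _ _)))

-- Sizes and costs

log-+-ordered : ∀ {a b} → a ≤ b → ⌊log₂ (a + b) ⌋ ≤ suc ⌊log₂ b ⌋
log-+-ordered {b = zero}  z≤n = z≤n
log-+-ordered {b = suc b} a≤b =
  ≤-trans (⌊log₂⌋-mono-≤ (+-mono-≤ a≤b (≤-reflexive (sym (+-identityʳ (suc b))))))
          (≤-reflexive (⌊log₂[2*b]⌋≡1+⌊log₂b⌋ (suc b)))

log-+ : ∀ a b → ⌊log₂ (a + b) ⌋ ≤ suc (⌊log₂ a ⌋ + ⌊log₂ b ⌋)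
log-+ a b with ≤-total a b
... | inj₁ a≤b = ≤-trans (log-+-ordered a≤b) (s≤s (m≤n+m _ ⌊log₂ a ⌋))
... | inj₂ b≤a = ≤-trans (≤-reflexive (cong ⌊log₂_⌋ (+-comm a b)))
                         (≤-trans (log-+-ordered b≤a) (s≤s (m≤m+n _ ⌊log₂ b ⌋)))

n<2*[1+⌊n/2⌋] : ∀ n → n < 2 * suc ⌊ n /2⌋
n<2*[1+⌊n/2⌋] zero          = s≤s z≤n
n<2*[1+⌊n/2⌋] (suc zero)    = s≤s (s≤s z≤n)
n<2*[1+⌊n/2⌋] (suc (suc n)) =
  ≤-trans (s≤s (s≤s (n<2*[1+⌊n/2⌋] n))) (≤-reflexive (sym (*-suc 2 (suc ⌊ n /2⌋))))

-- Strong induction along halving, which lowers the logarithm by one.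
n<2^[1+log₂n] : ∀ n → n < 2 ^ suc ⌊log₂ n ⌋
n<2^[1+log₂n] = <-rec _ λ where
  zero    rec → s≤s z≤n
  (suc zero) rec → s≤s (s≤s z≤n)
  n@(suc (suc m)) rec →
    ≤-trans (n<2*[1+⌊n/2⌋] n)
      (*-monoʳ-≤ 2 (subst (λ k → ⌊ n /2⌋ < 2 ^ k)
         (trans (cong suc (⌊log₂⌊n/2⌋⌋≡⌊log₂n⌋∸1 n))
                (m+[n∸m]≡n (⌊log₂⌋-mono-≤ {2} {n} (s≤s (s≤s z≤n)))))
         (rec (⌊n/2⌋<n (suc m)))))

-- Once both factors are bounded by powers of two, the product is bounded by a power of two, whose
-- logarithm is exact.
log-* : ∀ a b → ⌊log₂ (a * b) ⌋ ≤ suc (⌊log₂ a ⌋ + suc ⌊log₂ b ⌋)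
log-* a b = ≤-trans (⌊log₂⌋-mono-≤ (*-mono-≤ (<⇒≤ (n<2^[1+log₂n] a)) (<⇒≤ (n<2^[1+log₂n] b))))
  (≤-reflexive (trans (cong ⌊log₂_⌋ (sym (^-distribˡ-+-* 2 (suc ⌊log₂ a ⌋) (suc ⌊log₂ b ⌋))))
                      (⌊log₂[2^n]⌋≡n (suc ⌊log₂ a ⌋ + suc ⌊log₂ b ⌋))))

1≤size : ∀ v → 1 ≤ size v
1≤size nil        = s≤s z≤n
1≤size (num _)    = s≤s z≤n
1≤size (cons _ _) = s≤s z≤n

size-bool : ∀ b → size (bool b) ≤ 3
size-bool false = s≤s z≤n
size-bool true  = ≤-refl

size-num-mono : ∀ {a b} → a ≤ b → size (num a) ≤ size (num b)
size-num-mono a≤b = s≤s (⌊log₂⌋-mono-≤ a≤b)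

size-head′ : ∀ v → size (head′ v) ≤ size v
size-head′ nil        = ≤-refl
size-head′ (num _)    = s≤s z≤n
size-head′ (cons x y) = ≤-trans (m≤m+n _ _) (n≤1+n _)

size-tail′ : ∀ v → size (tail′ v) ≤ size v
size-tail′ nil        = ≤-refl
size-tail′ (num _)    = s≤s z≤n
size-tail′ (cons x y) = ≤-trans (m≤n+m _ _) (n≤1+n _)

quotient≤ : ∀ a b → quotient a b ≤ a
quotient≤ a zero    = z≤n
quotient≤ a (suc b) = m/n≤m a (suc b)

size-apply : ∀ o x y → size (apply o x y) ≤ suc (size x + size y)
size-apply add (num a) (num b) = s≤s (≤-trans (log-+ a b) (+-monoʳ-≤ (suc ⌊log₂ a ⌋) (n≤1+n _)))
size-apply sub (num a) (num b) = ≤-trans (size-num-mono (m∸n≤m a b)) (≤-trans (m≤m+n _ _) (n≤1+n _))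
size-apply mul (num a) (num b) = s≤s (log-* a b)
size-apply quo (num a) (num b) = ≤-trans (size-num-mono (quotient≤ a b)) (≤-trans (m≤m+n _ _) (n≤1+n _))
size-apply leq (num a) (num b) = ≤-trans (size-bool (a ≤ᵇ b)) (s≤s (+-mono-≤ (1≤size (num a)) (1≤size (num b))))
size-apply o nil        y          = s≤s z≤n
size-apply o (cons _ _) y          = s≤s z≤n
size-apply o (num _)    nil        = s≤s z≤n
size-apply o (num _)    (cons _ _) = s≤s z≤n

-- When no register exceeds B, `bulk e * B` bounds the size of the value of `e` and `effort e * B`
-- bounds its cost. Both coefficients are syntactic, so conditions on concrete expressions are
-- settled by computation.
bulk : ∀ {m} → Expr m → ℕ
bulk (var x)    = 1
bulk nil        = 1
bulk (num n)    = size (num n)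
bulk (cons e f) = suc (bulk e + bulk f)
bulk (hd e)     = bulk e
bulk (tl e)     = bulk e
bulk (op o e f) = suc (bulk e + bulk f)

effort : ∀ {m} → Expr m → ℕ
effort (var x)    = 1
effort nil        = 1
effort (num n)    = size (num n)
effort (cons e f) = bulk (cons e f) + (effort e + effort f)
effort (hd e)     = bulk e + effort e
effort (tl e)     = bulk e + effort e
effort (op o e f) = bulk (op o e f) + (effort e + effort f)

-- Expressions whose value is never larger than the largest register.
tame : ∀ {m} → Expr m → Bool
tame (var x)      = true
tame nil          = true
tame (num n)      = suc ⌊log₂ n ⌋ ≤ᵇ 3
tame (cons nil nil) = true
tame (cons _ _)   = false
tame (hd e)       = tame e
tame (tl e)       = tame e
tame (op sub e f) = tame e
tame (op quo e f) = tame e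
tame (op leq e f) = true
tame (op _ e f)   = false

-- Recursive rather than in closed form, so that one more iteration of a loop matches
-- the step count of run-loop definitionally.
loopSteps : ℕ → ℕ → ℕ
loopSteps k zero    = 1
loopSteps k (suc l) = 1 + k + loopSteps k l

loopSteps-mono : ∀ {k k′ l l′} → k ≤ k′ → l ≤ l′ → loopSteps k l ≤ loopSteps k′ l′
loopSteps-mono {l′ = zero}   k≤ z≤n      = ≤-refl
loopSteps-mono {l′ = suc l′} k≤ z≤n      = s≤s z≤n
loopSteps-mono               k≤ (s≤s l≤) = s≤s (+-mono-≤ k≤ (loopSteps-mono k≤ l≤))

loopSteps-closed : ∀ k l → loopSteps k l ≡ 1 + l * suc k
loopSteps-closed k zero    = refl
loopSteps-closed k (suc l) = trans (cong (suc k +_) (loopSteps-closed k l)) (+-suc (suc k) (l * suc k))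

-- Executions

module Execution (O : Oracle) (B : ℕ) (3≤B : 3 ≤ B) where

  Small : ∀ {m} → Store m → Set
  Small = VAll.All (λ v → size v ≤ B)

  small-lookup : ∀ {m} {σ : Store m} → Small σ → ∀ x → size (lookup σ x) ≤ B
  small-lookup sm x = lookup⁺ sm x

  small-update : ∀ {m} {σ : Store m} → Small σ → ∀ x {v} → size v ≤ B → Small (σ [ x ]≔ v)
  small-update (_ ∷ sm) zero    v≤ = v≤ ∷ sm
  small-update (s ∷ sm) (suc x) v≤ = s ∷ small-update sm x v≤

  weaken : ∀ k {n} → n ≤ k → n ≤ k * B
  weaken k n≤k = ≤-trans n≤k (m≤m*n k B {{>-nonZero (≤-trans (s≤s z≤n) 3≤B)}})

  add-bounds : ∀ {a b} k l → a ≤ k * B → b ≤ l * B → a + b ≤ (k + l) * B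
  add-bounds k l p q = ≤-trans (+-mono-≤ p q) (≤-reflexive (sym (*-distribʳ-+ B k l)))

  size-eval : ∀ {m} {σ : Store m} → Small σ → ∀ e → size (eval σ e) ≤ bulk e * B
  size-eval sm (var x)    = ≤-trans (small-lookup sm x) (≤-reflexive (sym (*-identityˡ B)))
  size-eval sm nil        = weaken 1 ≤-refl
  size-eval sm (num n)    = weaken (size (num n)) ≤-refl
  size-eval sm (cons e f) = add-bounds 1 (bulk e + bulk f) (weaken 1 ≤-refl)
                              (add-bounds (bulk e) (bulk f) (size-eval sm e) (size-eval sm f))
  size-eval {σ = σ} sm (hd e) = ≤-trans (size-head′ (eval σ e)) (size-eval sm e)
  size-eval {σ = σ} sm (tl e) = ≤-trans (size-tail′ (eval σ e)) (size-eval sm e)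
  size-eval {σ = σ} sm (op o e f) = ≤-trans (size-apply o (eval σ e) (eval σ f))
                            (add-bounds 1 (bulk e + bulk f) (weaken 1 ≤-refl)
                              (add-bounds (bulk e) (bulk f) (size-eval sm e) (size-eval sm f)))

  cost-eval : ∀ {m} {σ : Store m} → Small σ → ∀ e → cost σ e ≤ effort e * B
  cost-eval sm e@(var x) = ≤-trans (≤-reflexive (+-identityʳ _)) (size-eval sm e)
  cost-eval sm e@nil     = ≤-trans (≤-reflexive (+-identityʳ _)) (size-eval sm e)
  cost-eval sm e@(num n) = ≤-trans (≤-reflexive (+-identityʳ _)) (size-eval sm e)
  cost-eval sm g@(cons e f) = add-bounds (bulk g) (effort e + effort f) (size-eval sm g)
                                (add-bounds (effort e) (effort f) (cost-eval sm e) (cost-eval sm f))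
  cost-eval sm g@(hd e)  = add-bounds (bulk e) (effort e) (size-eval sm g) (cost-eval sm e)
  cost-eval sm g@(tl e)  = add-bounds (bulk e) (effort e) (size-eval sm g) (cost-eval sm e)
  cost-eval sm g@(op o e f) = add-bounds (bulk g) (effort e + effort f) (size-eval sm g)
                                (add-bounds (effort e) (effort f) (cost-eval sm e) (cost-eval sm f))

  tame-sub : ∀ x y → size x ≤ B → size (apply sub x y) ≤ B
  tame-sub (num a)    (num b)    x≤ = ≤-trans (size-num-mono (m∸n≤m a b)) x≤
  tame-sub nil        y          x≤ = x≤
  tame-sub (cons _ _) y          x≤ = ≤-trans (s≤s z≤n) 3≤B
  tame-sub (num _)    nil        x≤ = ≤-trans (s≤s z≤n) 3≤B
  tame-sub (num _)    (cons _ _) x≤ = ≤-trans (s≤s z≤n) 3≤B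

  tame-quo : ∀ x y → size x ≤ B → size (apply quo x y) ≤ B
  tame-quo (num a)    (num b)    x≤ = ≤-trans (size-num-mono (quotient≤ a b)) x≤
  tame-quo nil        y          x≤ = x≤
  tame-quo (cons _ _) y          x≤ = ≤-trans (s≤s z≤n) 3≤B
  tame-quo (num _)    nil        x≤ = ≤-trans (s≤s z≤n) 3≤B
  tame-quo (num _)    (cons _ _) x≤ = ≤-trans (s≤s z≤n) 3≤B

  tame-leq : ∀ x y → size (apply leq x y) ≤ B
  tame-leq (num a)    (num b)    = ≤-trans (size-bool (a ≤ᵇ b)) 3≤B
  tame-leq nil        y          = ≤-trans (s≤s z≤n) 3≤B
  tame-leq (cons _ _) y          = ≤-trans (s≤s z≤n) 3≤B
  tame-leq (num _)    nil        = ≤-trans (s≤s z≤n) 3≤B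
  tame-leq (num _)    (cons _ _) = ≤-trans (s≤s z≤n) 3≤B

  tame-small : ∀ {m} {σ : Store m} → Small σ → ∀ e → T (tame e) → size (eval σ e) ≤ B
  tame-small sm (var x) _ = small-lookup sm x
  tame-small sm nil _ = ≤-trans (s≤s z≤n) 3≤B
  tame-small sm (num n) p = ≤-trans (≤ᵇ⇒≤ (suc ⌊log₂ n ⌋) 3 p) 3≤B
  tame-small sm (cons nil nil) p = 3≤B
  tame-small {σ = σ} sm (hd e) p = ≤-trans (size-head′ (eval σ e)) (tame-small sm e p)
  tame-small {σ = σ} sm (tl e) p = ≤-trans (size-tail′ (eval σ e)) (tame-small sm e p)
  tame-small {σ = σ} sm (op sub e f) p = tame-sub (eval σ e) (eval σ f) (tame-small sm e p)
  tame-small {σ = σ} sm (op quo e f) p = tame-quo (eval σ e) (eval σ f) (tame-small sm e p)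
  tame-small {σ = σ} sm (op leq e f) p = tame-leq (eval σ e) (eval σ f)

  -- 100 is a generous bound on the effort of the expressions of the program below.
  stepTime : ℕ
  stepTime = 100 * B

  -- Boolean-valued, so that for a concrete expression `T (cheap e)` computes to the unit type and
  -- its implicit proof is filled in silently.
  cheap : ∀ {m} → Expr m → Bool
  cheap e = suc (effort e) ≤ᵇ 100

  charge : ∀ {m} {σ : Store m} → Small σ → ∀ e → T (cheap e) → 1 + cost σ e ≤ stepTime
  charge sm e p = ≤-trans (add-bounds 1 (effort e) (weaken 1 ≤-refl) (cost-eval sm e))
                          (*-monoˡ-≤ B (≤ᵇ⇒≤ (suc (effort e)) 100 p))

  -- Smallness of the registers is carried along with the execution, so that sequencing hands each
  -- command the bound it needs; `n` counts elementary steps, each paid for by one `stepTime`.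
  record Run {m : ℕ} (c : Cmd m) (σ : Store m) (n : ℕ) (σ′ : Store m) : Set where
    constructor run
    field
      execute : Small σ → Small σ′ × ∃[ t ] ((O ⊢ c , σ ⇓ σ′ [ t ]) × t ≤ n * stepTime)

  open Run public

  relax : ∀ {m} {c : Cmd m} {σ σ′ n n′} → n ≤ n′ → Run c σ n σ′ → Run c σ n′ σ′
  relax n≤ r = run λ sm →
    let sm′ , t , d , t≤ = execute r sm in sm′ , t , d , ≤-trans t≤ (*-monoˡ-≤ stepTime n≤)

  one : ∀ {t} → t ≤ stepTime → t ≤ 1 * stepTime
  one {t} = subst (t ≤_) (sym (*-identityˡ stepTime))

  run-skip : ∀ {m} {σ : Store m} → Run skip σ 1 σ
  run-skip = run λ sm → sm , 1 , ⇓skip , one (weaken 100 (s≤s z≤n))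

  infix 6 _:=_by_

  -- Serves the assignments that build larger values (the new residual, the output list and the
  -- final answer), whose size needs a separate argument.
  _:=_by_ : ∀ {m} {σ : Store m} x e → {p : T (cheap e)} → size (eval σ e) ≤ B →
            Run (x := e) σ 1 (σ [ x ]≔ eval σ e)
  _:=_by_ x e {p} v≤ = run λ sm → small-update sm x v≤ , _ , ⇓assign , one (charge sm e p)

  put : ∀ {m} {σ : Store m} x e {v} → {p : T (tame e)} → {q : T (cheap e)} → eval σ e ≡ v →
        Run (x := e) σ 1 (σ [ x ]≔ v)
  put x e {p = p} {q} refl = run λ sm → execute (_:=_by_ x e {q} (tame-small sm e p)) sm

  set : ∀ {m} {σ : Store m} x e → {p : T (tame e)} → {q : T (cheap e)} →
        Run (x := e) σ 1 (σ [ x ]≔ eval σ e)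
  set x e {p} {q} = put x e {p = p} {q} refl

  ask : ∀ {m} {σ : Store m} x q e {v} → {p : T (cheap e)} → O q (eval σ e) ≡ v → size v ≤ B →
        Run (x :=ask q ⟨ e ⟩) σ 1 (σ [ x ]≔ v)
  ask x q e {p = p} refl v≤ = run λ sm → small-update sm x v≤ , _ , ⇓ask , one (charge sm e p)

  infixr 5 _then_

  _then_ : ∀ {m} {c d : Cmd m} {σ σ′ σ″ k l} →
           Run c σ k σ′ → Run d σ′ l σ″ → Run (c ⨟ d) σ (k + l) σ″
  _then_ {k = k} {l} r r′ = run λ sm →
    let sm′ , s , D , s≤ = execute r sm
        sm″ , t , E , t≤ = execute r′ sm′
    in sm″ , s + t , ⇓seq D E ,
       ≤-trans (+-mono-≤ s≤ t≤) (≤-reflexive (sym (*-distribʳ-+ stepTime k l)))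

  run-cond : ∀ {m} {e} {c d : Cmd m} {σ σ′ k} → {p : T (cheap e)} →
             Run (if truthy (eval σ e) then c else d) σ k σ′ → Run (cond e c d) σ (1 + k) σ′
  run-cond {e = e} {p = p} r = run λ sm →
    let sm′ , s , D , s≤ = execute r sm
    in sm′ , _ , ⇓cond D , +-mono-≤ (charge sm e p) s≤

  run-stop : ∀ {m} {e} {c : Cmd m} {σ} → {p : T (cheap e)} → truthy (eval σ e) ≡ false →
             Run (while e c) σ 1 σ
  run-stop {e = e} {p = p} eq = run λ sm → sm , _ , ⇓stop eq , one (charge sm e p)

  run-loop : ∀ {m} {e} {c : Cmd m} {σ σ′ σ″ k l} → {p : T (cheap e)} → truthy (eval σ e) ≡ true →
             Run c σ k σ′ → Run (while e c) σ′ l σ″ → Run (while e c) σ (1 + k + l) σ″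
  run-loop {e = e} {k = k} {l} {p} eq r r′ = run λ sm →
    let sm′ , s , D , s≤ = execute r sm
        sm″ , t , E , t≤ = execute r′ sm′
    in sm″ , _ , ⇓loop eq D E ,
       ≤-trans (+-mono-≤ (+-mono-≤ (charge sm e p) s≤) t≤)
               (≤-reflexive (sym (*-distribʳ-+ stepTime (suc k) l)))

-- Multisets given by lists of pairs

count : ∀ {A : Set} → DecidableEquality A → List (A × ℕ) → A → ℕ
count _≟A_ []             a = 0
count _≟A_ ((b , n) ∷ ps) a with a ≟A b
... | yes _ = n
... | no  _ = count _≟A_ ps a

module FromPairs {A : Set} (_≟A_ : DecidableEquality A) where

  count-skip : ∀ {b n} ps {a} → ¬ (b ≡ a) → count _≟A_ ((b , n) ∷ ps) a ≡ count _≟A_ ps a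
  count-skip {b} ps {a} b≢a with a ≟A b
  ... | yes refl = contradiction refl b≢a
  ... | no  _    = refl

  count-here : ∀ {b n} ps → count _≟A_ ((b , n) ∷ ps) b ≡ n
  count-here {b} ps with b ≟A b
  ... | yes _   = refl
  ... | no  b≢b = contradiction refl b≢b

  count-entries : ∀ ps → Unique (map proj₁ ps) → All (λ p → count _≟A_ ps (proj₁ p) ≡ proj₂ p) ps
  count-entries []             _          = []
  count-entries ((b , n) ∷ ps) (b∉ ∷ uniq) =
    count-here ps ∷
    All.zipWith (λ (b≢a , eq) → trans (count-skip ps b≢a) eq) (All.map⁻ b∉ , count-entries ps uniq)

  count⁻ : ∀ ps {a} → 0 < count _≟A_ ps a → a ∈ map proj₁ ps
  count⁻ ((b , n) ∷ ps) {a} 0<c with a ≟A b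
  ... | yes a≡b = here a≡b
  ... | no  _   = there (count⁻ ps 0<c)

  count⁺ : ∀ ps {a} → All (λ p → 0 < proj₂ p) ps → a ∈ map proj₁ ps → 0 < count _≟A_ ps a
  count⁺ ((b , n) ∷ ps) {a} (0<n ∷ pos) a∈ with a ≟A b | a∈
  ... | yes _   | _          = 0<n
  ... | no  a≢b | here a≡b   = contradiction a≡b a≢b
  ... | no  _   | there a∈ps = count⁺ ps pos a∈ps

  fromPairs : ∀ ps → Unique (map proj₁ ps) → All (λ p → 0 < proj₂ p) ps → Multiset A
  fromPairs ps uniq pos = record
    { mult           = count _≟A_ ps
    ; support        = map proj₁ ps
    ; support-unique = uniq
    ; support-exact  = λ a → mk⇔ (count⁺ ps pos) (count⁻ ps)
    }

  represents-fromPairs : ∀ {k n} {E : Encoding A k n} {r} ps uniq pos →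
    Pointwise (λ e p → Encodes E (proj₁ e) (proj₁ p) × proj₂ e ≡ proj₂ p) r ps →
    Represents E r (fromPairs ps uniq pos)
  represents-fromPairs {E = E} ps uniq pos pw = map proj₁ ps , go (count-entries ps uniq) pw , ↭-refl
    where
    go : ∀ {r qs} → All (λ p → count _≟A_ ps (proj₁ p) ≡ proj₂ p) qs →
         Pointwise (λ e p → Encodes E (proj₁ e) (proj₁ p) × proj₂ e ≡ proj₂ p) r qs →
         Pointwise (λ e a → Encodes E (proj₁ e) a × proj₂ e ≡ count _≟A_ ps a) r (map proj₁ qs)
    go _          []                  = []
    go (eq ∷ eqs) ((enc , eq′) ∷ pw) = (enc , trans eq′ (sym eq)) ∷ go eqs pw

-- The greedy step

quotient-* : ∀ k {q} → 0 < q → quotient (k * q) q ≡ k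
quotient-* k {suc q} _ = m*n/n≡m k (suc q)

module Greedy (I : Instance) where
  open Instance I
  open SetoidPerm (setoid V) using (Unique-resp-↭)
  open IsTotalPreorder isTotalPreorder using () renaming (trans to ≼-trans)

  combine : (V → ℕ) → List V → U → ℕ
  combine ℓ vs u = sum (map (λ v → ℓ v * mult (F v) u) vs)

  -- Coefficients may vanish and are kept apart from the list of elements: deleting one element
  -- while keeping `ℓ` immediately solves the residual.
  Solvable : (U → ℕ) → Set
  Solvable g = ∃[ vs ] ∃[ ℓ ] Unique vs × (∀ u → combine ℓ vs u ≡ g u)

  -- By transitivity, anything in `F v` below `w` is below `τ v`, hence above `τ v` by minimality,
  -- hence above `w`. So `w` is itself minimal, and uniqueness applies.
  τ-least : ∀ v {w} → F v contains w → w ≼ τ v → w ≡ τ v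
  τ-least v {w} w∈ w≼τ = τ-unique v w
    (w∈ , λ x x∈ x≼w → ≼-trans w≼τ (proj₂ (τ-minimal v) x x∈ (≼-trans x≼w w≼τ)))

  positive-term : ∀ ℓ vs u → 0 < combine ℓ vs u → ∃[ v ] v ∈ vs × 0 < ℓ v * mult (F v) u
  positive-term ℓ (v ∷ vs) u 0<Σ with ℓ v * mult (F v) u in eq
  ... | suc k = v , here refl , subst (0 <_) (sym eq) (s≤s z≤n)
  ... | zero with positive-term ℓ vs u 0<Σ
  ...   | w , w∈ , 0<w = w , there w∈ , 0<w

  factors-positive : ∀ a b → 0 < a * b → 0 < a × 0 < b
  factors-positive (suc a) (suc b) _ = s≤s z≤n , s≤s z≤n
  factors-positive (suc a) zero    p = contradiction p (subst (λ k → ¬ (0 < k)) (sym (*-zeroʳ a)) λ ())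

  forced : ∀ {g u} → Solvable g → 0 < g u → (∀ w → 0 < g w → u ≼ w) →
           ∃[ v ] τ v ≡ u × ∃[ k ] ∃[ h ] g u ≡ k * mult (F v) u × Solvable h ×
             (∀ x → g x ≡ k * mult (F v) x + h x)
  forced {g} {u} (vs , ℓ , uniq , sol) 0<gu least
    with positive-term ℓ vs u (subst (0 <_) (sym (sol u)) 0<gu)
  ... | v , v∈ , 0<term with ∈-∃++ v∈
  ...   | xs , ys , refl = v , sym u≡τv , ℓ v , combine ℓ ws ,
      trans (split u) (trans (cong (ℓ v * mult (F v) u +_) rest-vanishes) (+-identityʳ _)) ,
      (ws , ℓ , uniq-tail , λ _ → refl) , split
    where
    ws = xs ++ ys

    perm : xs ++ v ∷ ys ↭ v ∷ ws
    perm = shift v xs ys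

    v∷ws-unique : Unique (v ∷ ws)
    v∷ws-unique = Unique-resp-↭ (↭⇒↭ₛ perm) uniq

    uniq-tail : Unique ws
    uniq-tail with v∷ws-unique
    ... | _ ∷ p = p

    split : ∀ x → g x ≡ ℓ v * mult (F v) x + combine ℓ ws x
    split x = trans (sym (sol x)) (sum-↭ (map⁺ (λ w → ℓ w * mult (F w) x) perm))

    -- Stated for every member of the solution because it is used twice: for `v` itself, and to
    -- exclude any other contributor at `u` by injectivity of `τ`. Leastness of `u` applies to `τ w`
    -- because the term of `w` alone makes `g (τ w)` positive.
    u≡τ : ∀ w → w ∈ v ∷ ws → 0 < ℓ w * mult (F w) u → u ≡ τ w
    u≡τ w w∈ 0<t = τ-least w (proj₂ pos) (least (τ w) (<-≤-trans 0<τ-term term≤g))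
      where
      pos = factors-positive (ℓ w) (mult (F w) u) 0<t
      0<τ-term : 0 < ℓ w * mult (F w) (τ w)
      0<τ-term = *-mono-< (proj₁ pos) (proj₁ (τ-minimal w))
      term≤combine : ∀ {zs} → w ∈ zs → ℓ w * mult (F w) (τ w) ≤ combine ℓ zs (τ w)
      term≤combine (here refl) = m≤m+n _ _
      term≤combine (there p)   = ≤-trans (term≤combine p) (m≤n+m _ _)
      term≤g : ℓ w * mult (F w) (τ w) ≤ g (τ w)
      term≤g = ≤-trans (term≤combine w∈) (≤-reflexive (sym (split (τ w))))

    u≡τv : u ≡ τ v
    u≡τv = u≡τ v (here refl) 0<term

    rest-vanishes : combine ℓ ws u ≡ 0
    rest-vanishes with combine ℓ ws u in eq
    ... | zero  = refl
    ... | suc k with positive-term ℓ ws u (subst (0 <_) (sym eq) (s≤s z≤n)) | v∷ws-unique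
    ...   | w , w∈ , 0<t | v∉ws ∷ _ =
      contradiction (τ-injective v w (trans (sym u≡τv) (u≡τ w (there w∈) 0<t))) (All.lookup v∉ws w∈)

  -- Replaces the unknown coefficient of `forced` by the quotient that the program computes;
  -- injectivity of `τ` identifies the forced element with `v`. The first two conclusions are
  -- exactly the tests of the program, and the third is what the next round needs.
  forced-quotient : ∀ {g u v m q} → Solvable g → 0 < g u → (∀ w → 0 < g w → u ≼ w) → τ v ≡ u →
    m ≡ g u → q ≡ mult (F v) u →
    m ≤ quotient m q * q × (∀ x → quotient m q * mult (F v) x ≤ g x) ×
    Solvable (λ x → g x ∸ quotient m q * mult (F v) x)
  forced-quotient {g} {u} {v} sol 0<gu least τv≡u refl refl with forced sol 0<gu least
  ... | w , τw≡u , k , h , gu≡ , (vs , ℓ , uniq , sol′) , split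
    rewrite τ-injective w v (trans τw≡u (sym τv≡u)) =
    ≤-reflexive (trans gu≡ (cong (_* mult (F v) u) (sym k≡))) ,
    (λ x → ≤-trans (≤-reflexive (cong (_* mult (F v) x) k≡)) (≤-trans (m≤m+n _ (h x)) (≤-reflexive (sym (split x))))) ,
    vs , ℓ , uniq , λ x → trans (sol′ x) (sym (trans (cong₂ (λ y z → y ∸ z * mult (F v) x) (split x) k≡)
                                                     (m+n∸m≡n (k * mult (F v) x) (h x))))
    where
    k≡ : quotient (g u) (mult (F v) u) ≡ k
    k≡ = trans (cong (λ x → quotient x (mult (F v) u)) gu≡)
               (quotient-* k (subst (λ x → 0 < mult (F v) x) τv≡u (proj₁ (τ-minimal v))))

  solution⇒solvable : ∀ {L} → IsSolution L → Solvable (mult K)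
  solution⇒solvable {L} sol = support L , mult L , support-unique L , sol

-- Subtraction of represented multisets

module Listings {A : Set} {k n : ℕ} (E : Encoding A k n) (same? : ∀ s t → Dec (SameElement E s t)) where

  Entry : (A → ℕ) → Str k n × ℕ → Set
  Entry g e = ∃[ a ] Encodes E (proj₁ e) a × proj₂ e ≡ g a × 0 < g a

  -- Relates a list to a bare function because residuals arise by pointwise subtraction, without an
  -- enumerated support. Repeated entries for one element are harmless: they all carry the value of
  -- `g`.
  record Listing (r : MultisetRepr k n) (g : A → ℕ) : Set where
    constructor listing
    field
      entries  : All (Entry g) r
      complete : ∀ a → 0 < g a → Any (λ e → Encodes E (proj₁ e) a) r

  open Listing public

  represents⇒listing : ∀ {r L} → Represents E r L → Listing r (mult L)
  represents⇒listing {r} {L} (as , pw , as↭) = listing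
    (all pw (λ a∈ → Equivalence.to (support-exact L _) (∈-resp-↭ as↭ a∈)))
    (λ a 0<a → any pw (∈-resp-↭ (↭-sym as↭) (Equivalence.from (support-exact L a) 0<a)))
    where
    Matches : Str k n × ℕ → A → Set
    Matches e a = Encodes E (proj₁ e) a × proj₂ e ≡ mult L a

    all : ∀ {r as} → Pointwise Matches r as → (∀ {a} → a ∈ as → 0 < mult L a) → All (Entry (mult L)) r
    all []                 pos = []
    all ((enc , eq) ∷ pw) pos = (_ , enc , eq , pos (here refl)) ∷ all pw (λ a∈ → pos (there a∈))

    any : ∀ {r as a} → Pointwise Matches r as → a ∈ as → Any (λ e → Encodes E (proj₁ e) a) r
    any ((enc , _) ∷ _) (here refl) = here enc
    any (_ ∷ pw)        (there a∈)  = there (any pw a∈)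

  decode-unique : ∀ {s a b} → Encodes E s a → Encodes E s b → a ≡ b
  decode-unique p q = just-injective (trans (sym p) q)

  -- Follows the loop `scan`, which overwrites its result at every match and runs to the end of the
  -- list; `d` is the current content of `$found`.
  find : MultisetRepr k n → Str k n → ℕ → ℕ
  find []            s d = d
  find ((t , m) ∷ r) s d = find r s (if does (same? s t) then m else d)

  find-stable : ∀ {r g s a} → All (Entry g) r → Encodes E s a → find r s (g a) ≡ g a
  find-stable []       _ = refl
  find-stable {(t , m) ∷ r} {s = s} ((b , enc-t , refl , _) ∷ es) enc-s with same? s t
  ... | no  _ = find-stable es enc-s
  ... | yes (x , sx , tx)
    rewrite decode-unique enc-s sx | decode-unique enc-t tx = find-stable es sx

  find-entry : ∀ {r g s a} d → All (Entry g) r → Encodes E s a →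
               Any (λ e → Encodes E (proj₁ e) a) r → find r s d ≡ g a
  find-entry {(t , m) ∷ r} {s = s} d ((b , enc-t , refl , _) ∷ es) enc-s (here enc-t′) with same? s t
  ... | no  ¬same = contradiction (_ , enc-s , enc-t′) ¬same
  ... | yes _ rewrite decode-unique enc-t enc-t′ = find-stable es enc-s
  find-entry {(t , m) ∷ r} {s = s} d (_ ∷ es) enc-s (there p) = find-entry _ es enc-s p

  -- If `g a` is 0, the initial 0 is already right and no match can change it; otherwise
  -- completeness supplies a match, after which the value is stable.
  find-listing : ∀ {r g s a} → Listing r g → Encodes E s a → find r s 0 ≡ g a
  find-listing {r} {g} {s} {a} l enc with g a in eq
  ... | zero  = trans (cong (find r s) (sym eq)) (trans (find-stable (entries l) enc) eq)
  ... | suc n = trans (find-entry 0 (entries l) enc (complete l a (subst (0 <_) (sym eq) (s≤s z≤n)))) eq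

  -- Dropping zeros keeps the listed multiplicities positive and is the source of the progress made
  -- in each round.
  push : ℕ → Str k n → MultisetRepr k n → MultisetRepr k n
  push zero    s acc = acc
  push (suc m) s acc = (s , suc m) ∷ acc

  subtract : ℕ → MultisetRepr k n → MultisetRepr k n → MultisetRepr k n → MultisetRepr k n
  subtract c f acc []            = acc
  subtract c f acc ((s , m) ∷ r) = subtract c f (push (m ∸ c * find f s 0) s acc) r

  -- The flag is only ever cleared, so a second test can be conjoined by passing its result as the
  -- initial flag.
  fits : MultisetRepr k n → ℕ → Bool → MultisetRepr k n → Bool
  fits r c b []            = b
  fits r c b ((s , m) ∷ f) = fits r c (if c * m ≤ᵇ find r s 0 then b else false) f

  fits-false : ∀ r c f → fits r c false f ≡ false
  fits-false r c []            = refl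
  fits-false r c ((s , m) ∷ f) with c * m ≤ᵇ find r s 0
  ... | true  = fits-false r c f
  ... | false = fits-false r c f

  fits-sound : ∀ r c b f → fits r c b f ≡ true →
               b ≡ true × All (λ e → c * proj₂ e ≤ find r (proj₁ e) 0) f
  fits-sound r c b []            eq = eq , []
  fits-sound r c b ((s , m) ∷ f) eq with c * m ≤ᵇ find r s 0 in le
  ... | true  = let b≡ , all = fits-sound r c b f eq in
                b≡ , ≤ᵇ⇒≤ _ _ (subst T (sym le) _) ∷ all
  ... | false = contradiction (trans (sym (fits-false r c f)) eq) λ ()

  fits-complete : ∀ r c f → All (λ e → c * proj₂ e ≤ find r (proj₁ e) 0) f → fits r c true f ≡ true
  fits-complete r c []            []       = refl
  fits-complete r c ((s , m) ∷ f) (p ∷ ps) with c * m ≤ᵇ find r s 0 in le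
  ... | true  = fits-complete r c f ps
  ... | false = contradiction (subst T le (≤⇒≤ᵇ p)) λ ()

  push-length : ∀ m s acc → length (push m s acc) ≤ suc (length acc)
  push-length zero    s acc = n≤1+n _
  push-length (suc m) s acc = ≤-refl

  subtract-length : ∀ c f acc r → length (subtract c f acc r) ≤ length acc + length r
  subtract-length c f acc []            = m≤m+n _ _
  subtract-length c f acc ((s , m) ∷ r) =
    ≤-trans (subtract-length c f _ r)
    (≤-trans (+-monoˡ-≤ (length r) (push-length (m ∸ c * find f s 0) s acc))
             (≤-reflexive (sym (+-suc _ _))))

  push-size : ∀ {x m} s acc → x ≤ m →
              size (reprVal (push x s acc)) ≤ suc (suc (size (strVal s) + size (num m))) + size (reprVal acc)
  push-size {zero}  s acc x≤m = m≤n+m _ _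
  push-size {suc x} s acc x≤m = s≤s (+-monoˡ-≤ (size (reprVal acc))
                                 (s≤s (+-monoʳ-≤ (size (strVal s)) (size-num-mono x≤m))))

  -- Total size of accumulator and remaining list is a potential: processing an entry never raises
  -- it, which keeps the accumulator small throughout the subtraction loop.
  push-size-+ : ∀ {x m} s acc r → x ≤ m →
                size (reprVal (push x s acc)) + size (reprVal r) ≤
                size (reprVal acc) + size (reprVal ((s , m) ∷ r))
  push-size-+ {x} {m} s acc r x≤m = ≤-trans (+-monoˡ-≤ (size (reprVal r)) (push-size s acc x≤m))
    (≤-reflexive (trans (cong (_+ size (reprVal r)) (+-comm _ (size (reprVal acc))))
                        (+-assoc (size (reprVal acc)) _ _)))

  -- The `+ 1` accounts for the final `nil`: the two given lists have one each, the result only one.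
  subtract-size : ∀ c f acc r → size (reprVal (subtract c f acc r)) + 1 ≤ size (reprVal acc) + size (reprVal r)
  subtract-size c f acc []            = ≤-refl
  subtract-size c f acc ((s , m) ∷ r) =
    ≤-trans (subtract-size c f _ r) (push-size-+ s acc r (m∸n≤m m (c * find f s 0)))

  fits⇒≤ : ∀ c {f h r g} → Listing f h → Listing r g →
           All (λ e → c * proj₂ e ≤ find r (proj₁ e) 0) f → ∀ a → c * h a ≤ g a
  fits⇒≤ c {f} {h} {r} {g} lf lr fit a with h a in eq
  ... | zero  = ≤-trans (≤-reflexive (*-zeroʳ c)) z≤n
  ... | suc _ = subst (λ x → c * x ≤ g a) eq
                  (go (entries lf) fit (complete lf a (subst (0 <_) (sym eq) (s≤s z≤n))))
    where
    go : ∀ {f} → All (Entry h) f → All (λ e → c * proj₂ e ≤ find r (proj₁ e) 0) f →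
         Any (λ e → Encodes E (proj₁ e) a) f → c * h a ≤ g a
    go ((b , enc , m≡ , _) ∷ _) (fit ∷ _) (here enc′) =
      subst₂ (λ x y → c * x ≤ y) (trans m≡ (cong h (decode-unique enc enc′))) (find-listing lr enc′) fit
    go (_ ∷ es) (_ ∷ fit) (there p) = go es fit p

  ≤⇒fits : ∀ c {f h r g} → All (Entry h) f → Listing r g → (∀ a → c * h a ≤ g a) →
           All (λ e → c * proj₂ e ≤ find r (proj₁ e) 0) f
  ≤⇒fits c es lr le = All.map
    (λ (a , enc , m≡ , _) → subst₂ (λ x y → c * x ≤ y) (sym m≡) (sym (find-listing lr enc)) (le a)) es

  value-size : ∀ {r g a} → All (Entry g) r → Any (λ e → Encodes E (proj₁ e) a) r →
               size (num (g a)) ≤ size (reprVal r)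
  value-size {(s , m) ∷ r} {g} ((b , enc , m≡ , _) ∷ _) (here enc′) = ≤-trans
    (≤-reflexive (cong (λ x → size (num x)) (trans (cong g (decode-unique enc′ enc)) (sym m≡))))
    (≤-trans (m≤n+m _ (size (strVal s))) (≤-trans (n≤1+n _) (≤-trans (m≤m+n _ (size (reprVal r))) (n≤1+n _))))
  value-size {e ∷ r} (_ ∷ es) (there p) =
    ≤-trans (value-size es p) (≤-trans (m≤n+m _ _) (n≤1+n _))

  module _ {c : ℕ} {f : MultisetRepr k n} {h : A → ℕ} (lf : Listing f h) where

    private
      _⊖_ : (A → ℕ) → (A → ℕ) → A → ℕ
      (g ⊖ h′) a = g a ∸ c * h′ a

    push-entry : ∀ {g s a} m {acc} → Encodes E s a → m ≡ (g ⊖ h) a →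
                 All (Entry (g ⊖ h)) acc → All (Entry (g ⊖ h)) (push m s acc)
    push-entry zero    enc eq acc = acc
    push-entry (suc m) enc eq acc = (_ , enc , eq , subst (0 <_) eq (s≤s z≤n)) ∷ acc

    residual : ∀ {g s m} → (e : Entry g (s , m)) → m ∸ c * find f s 0 ≡ (g ⊖ h) (proj₁ e)
    residual {g} (a , enc , m≡ , _) = cong₂ (λ x y → x ∸ c * y) m≡ (find-listing lf enc)

    subtract-entries : ∀ {g} acc {r} → All (Entry (g ⊖ h)) acc → All (Entry g) r →
                       All (Entry (g ⊖ h)) (subtract c f acc r)
    subtract-entries acc done []       = done
    subtract-entries acc done (e@(_ , enc , _) ∷ es) =
      subtract-entries _ (push-entry _ enc (residual e) done) es

    Covers : A → MultisetRepr k n → Set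
    Covers a = Any (λ e → Encodes E (proj₁ e) a)

    push-keeps : ∀ m s {acc a} → Covers a acc → Covers a (push m s acc)
    push-keeps zero    s p = p
    push-keeps (suc m) s p = there p

    subtract-keeps : ∀ {a} acc r → Covers a acc → Covers a (subtract c f acc r)
    subtract-keeps acc []            p = p
    subtract-keeps acc ((s , m) ∷ r) p = subtract-keeps _ r (push-keeps (m ∸ c * find f s 0) s p)

    subtract-covers : ∀ {g a} acc {r} → All (Entry g) r → 0 < (g ⊖ h) a →
                      Covers a r → Covers a (subtract c f acc r)
    subtract-covers acc {(s , m) ∷ r} (e ∷ es) 0<a (there p) = subtract-covers _ es 0<a p
    subtract-covers {g} {a} acc {(s , m) ∷ r} (e ∷ es) 0<a (here enc) =
      subtract-keeps _ r (pushed (m ∸ c * find f s 0) (trans (residual e)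
        (cong (g ⊖ h) (decode-unique (proj₁ (proj₂ e)) enc))))
      where
      pushed : ∀ x → x ≡ (g ⊖ h) a → Covers a (push x s acc)
      pushed zero    eq = contradiction (subst (0 <_) (sym eq) 0<a) λ ()
      pushed (suc x) eq = here enc

    subtract-listing : ∀ {g r} → Listing r g → Listing (subtract c f [] r) (g ⊖ h)
    subtract-listing {g} l = listing (subtract-entries [] [] (entries l))
      (λ a 0<a → subtract-covers [] (entries l) 0<a
                   (complete l a (<-≤-trans 0<a (m∸n≤m (g a) (c * h a)))))

    -- The entry for `a` leaves the difference 0, which `push` drops; every other entry adds at most
    -- one to the length.
    subtract-shrinks : ∀ {g a} acc {r} → All (Entry g) r → (g ⊖ h) a ≡ 0 → Covers a r →
                       length (subtract c f acc r) < length acc + length r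
    subtract-shrinks {g} {a} acc {(s , m) ∷ r} (e ∷ es) 0≡ (here enc)
      rewrite trans (residual e) (trans (cong (g ⊖ h) (decode-unique (proj₁ (proj₂ e)) enc)) 0≡) =
      ≤-trans (s≤s (subtract-length c f acc r)) (≤-reflexive (sym (+-suc _ _)))
    subtract-shrinks acc {(s , m) ∷ r} (e ∷ es) 0≡ (there p) =
      ≤-trans (subtract-shrinks _ es 0≡ p)
      (≤-trans (+-monoˡ-≤ (length r) (push-length (m ∸ c * find f s 0) s acc))
               (≤-reflexive (sym (+-suc _ _))))

-- The program

pattern $io    = 0F
pattern $reply = 1F
pattern $list  = 2F
pattern $key   = 3F
pattern $found = 4F
pattern $todo  = 5F
pattern $new   = 6F
pattern $best  = 7F
pattern $coeff = 8F
pattern $F     = 9F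
pattern $K     = suc 9F
pattern $ok    = suc (suc 9F)
pattern $v     = suc (suc (suc 9F))
pattern $L     = suc (suc (suc (suc 9F)))

Code : Set
Code = Cmd 14

-- All loops reset their scratch registers, so that the stores before and after a loop
-- can be written out.

scanBody : Code
scanBody = $reply :=ask equalU ⟨ cons (var $key) (hd (hd (var $list))) ⟩
         ⨟ cond (var $reply) ($found := tl (hd (var $list))) skip
         ⨟ $reply := nil
         ⨟ $list := tl (var $list)

scan : Code
scan = while (var $list) scanBody

find-in : Fin 14 → Expr 14 → Code
find-in x e = $list := var x ⨟ $key := e ⨟ $found := num 0 ⨟ scan

minBody : Code
minBody = $reply :=ask compare ⟨ cons (hd (hd (var $todo))) (hd (var $best)) ⟩
        ⨟ cond (var $reply) ($best := hd (var $todo)) skip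
        ⨟ $reply := nil
        ⨟ $todo := tl (var $todo)

fitsBody : Code
fitsBody = find-in $K (hd (hd (var $todo)))
         ⨟ cond (op leq (op mul (var $coeff) (tl (hd (var $todo)))) (var $found)) skip ($ok := nil)
         ⨟ $todo := tl (var $todo)
         ⨟ $key := nil
         ⨟ $found := nil

subtractBody : Code
subtractBody = find-in $F (hd (hd (var $todo)))
             ⨟ $found := op sub (tl (hd (var $todo))) (op mul (var $coeff) (var $found))
             ⨟ cond (op leq (num 1) (var $found))
                    ($new := cons (cons (var $key) (var $found)) (var $new)) skip
             ⨟ $todo := tl (var $todo)
             ⨟ $key := nil
             ⨟ $found := nil

update : Code
update = $L := cons (cons (hd (var $v)) (var $coeff)) (var $L)
       ⨟ $todo := var $K
       ⨟ while (var $todo) subtractBody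
       ⨟ $K := var $new
       ⨟ $new := nil
       ⨟ $best := nil
       ⨟ $coeff := nil
       ⨟ $F := nil
       ⨟ $v := nil

attempt : Code
attempt = $F :=ask family ⟨ hd (var $v) ⟩
        ⨟ find-in $F (hd (var $best))
        ⨟ $coeff := op quo (tl (var $best)) (var $found)
        -- The product of a rounded-down quotient with its divisor never exceeds the dividend, so
        -- this inequality tests exact divisibility.
        ⨟ $ok := op leq (tl (var $best)) (op mul (var $coeff) (var $found))
        ⨟ $key := nil
        ⨟ $found := nil
        ⨟ $todo := var $F
        ⨟ while (var $todo) fitsBody
        -- Emptying `$K` leaves the main loop; `$ok` then tells failure from a fully covered `K`.
        ⨟ cond (var $ok) update ($K := nil)

mainBody : Code
mainBody = $best := hd (var $K)
         ⨟ $todo := tl (var $K)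
         ⨟ while (var $todo) minBody
         ⨟ $v :=ask triangle ⟨ hd (var $best) ⟩
         ⨟ cond (var $v) attempt ($K := nil ⨟ $ok := nil)

output : Code
output = cond (var $ok) ($io := cons (var $L) nil) ($io := nil)

program : Program
program = record
  { auxiliary = 13
  ; body = $ok := cons nil nil
         ⨟ $K := hd (tl (tl (tl (tl (var $io)))))
         ⨟ while (var $K) mainBody
         ⨟ output
  }

-- The constants count the assignments, queries and tests between loops, and the bracketing follows
-- the sequencing of the code, so that the counts of composed runs agree definitionally. Every loop
-- over a list is charged for `n` iterations.
findSteps fitsSteps subtractSteps updateSteps attemptSteps mainSteps totalSteps : ℕ → ℕ
findSteps n     = 3 + loopSteps 5 n
fitsSteps n     = loopSteps (findSteps n + 5) n
subtractSteps n = loopSteps (findSteps n + 6) n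
updateSteps n   = 2 + (subtractSteps n + 6)
attemptSteps n  = 1 + (findSteps n + (5 + (fitsSteps n + (1 + updateSteps n))))
mainSteps n     = 2 + (loopSteps 5 n + (2 + attemptSteps n))
totalSteps n    = 2 + (loopSteps (mainSteps n) n + 2)

-- A string has at most n letters, each of size at most n with its list cell; an output entry adds
-- two cells and a coefficient of size at most n; each of at most n rounds adds one entry.
stringBound entryBound outputBound registerBound timeBound : ℕ → ℕ
stringBound n   = 1 + n * (1 + n)
entryBound n    = 2 + (stringBound n + n)
outputBound n   = 1 + n * entryBound n
registerBound n = 3 + (outputBound n + (stringBound n + n))
timeBound n     = totalSteps n * (100 * registerBound n)

entryVal : ∀ {k n} → Str k n × ℕ → Val
entryVal e = cons (strVal (proj₁ e)) (num (proj₂ e))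

-- Runs of the individual loops

module Verification (I : Instance) (O : Oracle) (answers : Answers I O) (B : ℕ) (3≤B : 3 ≤ B) where
  open Instance I
  open Answers answers
  open Execution O B 3≤B public
  open IsTotalPreorder isTotalPreorder using (total) renaming (trans to ≼-trans; refl to ≼-refl)

  sameU? : ∀ s t → Dec (SameElement encU s t)
  sameU? s t = proj₁ (equalU-ok s t)

  open Listings encU sameU? public

  small-bool : ∀ b → size (bool b) ≤ B
  small-bool b = ≤-trans (size-bool b) 3≤B

  scan-run : ∀ r s d {io rest} →
    Run scan (io ∷ nil ∷ reprVal r ∷ strVal s ∷ num d ∷ rest) (loopSteps 5 (length r))
             (io ∷ nil ∷ nil ∷ strVal s ∷ num (find r s d) ∷ rest)
  scan-run []            s d = run-stop refl
  -- Abstracting the Boolean makes the oracle answer and the conditional inside `find` depend on the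
  -- same `b`.
  scan-run ((t , m) ∷ r) s d {io} {rest} with does (sameU? s t) | proj₂ (equalU-ok s t)
  ... | b | eq = run-loop refl
      (ask $reply equalU _ eq (small-bool b) then choose b then set $reply nil then set $list (tl (var $list)))
      (scan-run r s _)
    where
    choose : ∀ b → Run (cond (var $reply) ($found := tl (hd (var $list))) skip)
      (io ∷ bool b ∷ reprVal ((t , m) ∷ r) ∷ strVal s ∷ num d ∷ rest) 2
      (io ∷ bool b ∷ reprVal ((t , m) ∷ r) ∷ strVal s ∷ num (if b then m else d) ∷ rest)
    choose true  = run-cond (set $found (tl (hd (var $list))))
    choose false = run-cond run-skip

  -- The key is evaluated after `$list` has been filled, hence the different stores in the two
  -- equations.
  find-run : ∀ x e {p : T (tame e)} {q : T (cheap e)} r s {n io rest} → length r ≤ n →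
    lookup (io ∷ nil ∷ nil ∷ nil ∷ nil ∷ rest) x ≡ reprVal r →
    eval (io ∷ nil ∷ reprVal r ∷ nil ∷ nil ∷ rest) e ≡ strVal s →
    Run (find-in x e) (io ∷ nil ∷ nil ∷ nil ∷ nil ∷ rest) (findSteps n)
        (io ∷ nil ∷ nil ∷ strVal s ∷ num (find r s 0) ∷ rest)
  find-run x e {p} {q} r s r≤n r-in s-in =
    put $list (var x) r-in then put $key e {p = p} {q} s-in then set $found (num 0) then
    relax (loopSteps-mono ≤-refl r≤n) (scan-run r s 0)

  -- `u′ ≼ u` is returned too, because the caller starts with the first entry as candidate `b` and
  -- needs the minimum to lie below that one as well.
  min-run : ∀ r b {g u} → Encodes encU (proj₁ b) u → proj₂ b ≡ g u → 0 < g u → All (Entry g) r →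
    ∃[ b′ ] ∃[ u′ ] Encodes encU (proj₁ b′) u′ × proj₂ b′ ≡ g u′ × 0 < g u′ × u′ ≼ u ×
      All (λ e → ∀ w → Encodes encU (proj₁ e) w → u′ ≼ w) r ×
      (∀ {io list key found new rest} →
        Run (while (var $todo) minBody)
            (io ∷ nil ∷ list ∷ key ∷ found ∷ reprVal r ∷ new ∷ entryVal b ∷ rest) (loopSteps 5 (length r))
            (io ∷ nil ∷ list ∷ key ∷ found ∷ nil ∷ new ∷ entryVal b′ ∷ rest))
  min-run [] b enc eq 0<g [] = b , _ , enc , eq , 0<g , ≼-refl , [] , run-stop refl
  min-run ((t , m) ∷ r) b {u = u} enc eq 0<g ((w , enc-w , eq-w , 0<gw) ∷ es)
    with compare-ok t (proj₁ b) w u enc-w enc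
  ... | yes w≼u , answer =
    let b′ , u′ , enc′ , eq′ , 0<g′ , u′≼w , least , loop = min-run r (t , m) enc-w eq-w 0<gw es in
    b′ , u′ , enc′ , eq′ , 0<g′ , ≼-trans u′≼w w≼u ,
    (λ x enc-x → subst (u′ ≼_) (decode-unique enc-w enc-x) u′≼w) ∷ least ,
    run-loop refl
      (ask $reply compare _ answer (small-bool true) then run-cond (set $best (hd (var $todo)))
        then set $reply nil then set $todo (tl (var $todo)))
      loop
  ... | no w⋠u , answer =
    let b′ , u′ , enc′ , eq′ , 0<g′ , u′≼u , least , loop = min-run r b enc eq 0<g es in
    b′ , u′ , enc′ , eq′ , 0<g′ , u′≼u ,
    (λ x enc-x → subst (u′ ≼_) (decode-unique enc-w enc-x) (≼-trans u′≼u u≼w)) ∷ least ,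
    run-loop refl
      (ask $reply compare _ answer (small-bool false) then run-cond run-skip
        then set $reply nil then set $todo (tl (var $todo)))
      loop
    where
    u≼w : u ≼ w
    u≼w with total u w
    ... | inj₁ u≼w = u≼w
    ... | inj₂ w≼u = contradiction w≼u w⋠u

  fits-run : ∀ r c f b {n io new best F rest} → length r ≤ n →
    Run (while (var $todo) fitsBody)
        (io ∷ nil ∷ nil ∷ nil ∷ nil ∷ reprVal f ∷ new ∷ best ∷ num c ∷ F ∷ reprVal r ∷ bool b ∷ rest)
        (loopSteps (findSteps n + 5) (length f))
        (io ∷ nil ∷ nil ∷ nil ∷ nil ∷ nil ∷ new ∷ best ∷ num c ∷ F ∷ reprVal r ∷ bool (fits r c b f) ∷ rest)
  fits-run r c []            b r≤n = run-stop refl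
  fits-run r c ((s , m) ∷ f) b {n} {io} {new} {best} {F} {rest} r≤n = run-loop refl
      (find-run $K (hd (hd (var $todo))) r s r≤n refl refl then run-cond (choose (c * m ≤ᵇ find r s 0))
        then set $todo (tl (var $todo)) then set $key nil then set $found nil)
      (fits-run r c f _ r≤n)
    where
    choose : ∀ b′ → Run (if truthy (bool b′) then skip else ($ok := nil))
      (io ∷ nil ∷ nil ∷ strVal s ∷ num (find r s 0) ∷ reprVal ((s , m) ∷ f) ∷ new
         ∷ best ∷ num c ∷ F ∷ reprVal r ∷ bool b ∷ rest) 1
      (io ∷ nil ∷ nil ∷ strVal s ∷ num (find r s 0) ∷ reprVal ((s , m) ∷ f) ∷ new
         ∷ best ∷ num c ∷ F ∷ reprVal r ∷ bool (if b′ then b else false) ∷ rest)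
    choose true  = run-skip
    choose false = set $ok nil

  subtract-run : ∀ r c f acc {n io best rest} → length f ≤ n → size (reprVal acc) + size (reprVal r) ≤ B →
    Run (while (var $todo) subtractBody)
        (io ∷ nil ∷ nil ∷ nil ∷ nil ∷ reprVal r ∷ reprVal acc ∷ best ∷ num c ∷ reprVal f ∷ rest)
        (loopSteps (findSteps n + 6) (length r))
        (io ∷ nil ∷ nil ∷ nil ∷ nil ∷ nil ∷ reprVal (subtract c f acc r) ∷ best ∷ num c ∷ reprVal f ∷ rest)
  subtract-run []            c f acc f≤n ≤B = run-stop refl
  subtract-run ((s , m) ∷ r) c f acc {n} {io} {best} {rest} f≤n ≤B = run-loop refl
      (find-run $F (hd (hd (var $todo))) f s f≤n refl refl
        then set $found (op sub (tl (hd (var $todo))) (op mul (var $coeff) (var $found)))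
        then append (m ∸ c * find f s 0) (m+n≤o⇒m≤o _ rest≤B)
        then set $todo (tl (var $todo)) then set $key nil then set $found nil)
      (subtract-run r c f _ f≤n rest≤B)
    where
    rest≤B : size (reprVal (push (m ∸ c * find f s 0) s acc)) + size (reprVal r) ≤ B
    rest≤B = ≤-trans (push-size-+ s acc r (m∸n≤m m (c * find f s 0))) ≤B

    append : ∀ x → size (reprVal (push x s acc)) ≤ B →
      Run (cond (op leq (num 1) (var $found)) ($new := cons (cons (var $key) (var $found)) (var $new)) skip)
        (io ∷ nil ∷ nil ∷ strVal s ∷ num x ∷ reprVal ((s , m) ∷ r)
         ∷ reprVal acc ∷ best ∷ num c ∷ reprVal f ∷ rest) 2
        (io ∷ nil ∷ nil ∷ strVal s ∷ num x ∷ reprVal ((s , m) ∷ r)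
         ∷ reprVal (push x s acc) ∷ best ∷ num c ∷ reprVal f ∷ rest)
    append zero   _  = run-cond run-skip
    append (suc x) ≤B = run-cond ($new := cons (cons (var $key) (var $found)) (var $new) by ≤B)

-- Correctness and running time

element-size : ∀ {A : Set} (f : A → Val) {x xs} → x ∈ xs → size (f x) ≤ size (listVal f xs)
element-size f (here refl) = ≤-trans (m≤m+n _ _) (n≤1+n _)
element-size f (there x∈)  = ≤-trans (element-size f x∈) (≤-trans (m≤n+m _ _) (n≤1+n _))

length-size : ∀ {A : Set} (f : A → Val) xs → length xs ≤ size (listVal f xs)
length-size f []       = z≤n
length-size f (x ∷ xs) = s≤s (≤-trans (length-size f xs) (m≤n+m _ (size (f x))))

-- Each letter occurs in the explicitly given alphabet, so its size is bounded by that of the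
-- alphabet. This bounds the strings returned by the triangle oracle in terms of the input.
string-size : ∀ {k n} (s : Str k n) → size (strVal s) ≤ 1 + n * (1 + size (alphabetVal k))
string-size []          = ≤-refl
string-size {k} {suc n} (i ∷ s) = s≤s (≤-trans
  (+-mono-≤ (element-size letterVal (∈-allFin i)) (string-size s))
  (≤-reflexive (+-suc _ _)))

1≤loopSteps : ∀ k l → 1 ≤ loopSteps k l
1≤loopSteps k zero    = ≤-refl
1≤loopSteps k (suc l) = s≤s z≤n

module Main (I : Instance) (O : Oracle) (answers : Answers I O)
            (M : ℕ) (family-length : FamilyLength≤ I O M) where
  open Instance I
  open Answers answers
  open Greedy I

  n : ℕ
  n = size (inputVal I) + M

  B : ℕ
  B = registerBound n

  open Verification I O answers B (m≤m+n 3 _)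

  -- Decides equality through chosen encodings, so that the multiplicity of the output multiset can
  -- be defined as a function on `V`.
  _≟V_ : DecidableEquality V
  v ≟V w with encodable encV v | encodable encV w
  ... | s , enc-v | t , enc-w with proj₁ (equalV-ok s t)
  ...   | yes (x , sx , tx) = yes (just-injective (trans (sym enc-v) (trans sx (trans (sym tx) enc-w))))
  ...   | no  ¬same         = no λ where refl → ¬same (v , enc-v , enc-w)

  open FromPairs _≟V_

  n≤B : n ≤ B
  n≤B = ≤-trans (m≤n+m n (stringBound n)) (≤-trans (m≤n+m _ (outputBound n)) (m≤n+m _ 3))

  component-size : ∀ {x} →
    x ∈ (alphabetVal k₁ ∷ alphabetVal k₂ ∷ unaryVal n₁ ∷ unaryVal n₂ ∷ reprVal K-repr ∷ []) →
    size x ≤ n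
  component-size x∈ = ≤-trans (element-size id x∈) (m≤m+n _ M)

  n₂≤n : n₂ ≤ n
  n₂≤n = ≤-trans (≤-reflexive (sym (length-replicate n₂ {nil})))
           (≤-trans (length-size id (replicate n₂ nil)) (component-size (there (there (there (here refl))))))

  V-string-size : (s : Str k₂ n₂) → size (strVal s) ≤ stringBound n
  V-string-size s = ≤-trans (string-size s)
    (s≤s (*-mono-≤ n₂≤n (s≤s (component-size (there (here refl))))))

  output-fits : ∀ {x} → x ≤ outputBound n → 2 + x ≤ B
  output-fits x≤ = ≤-trans (+-monoʳ-≤ 2 x≤) (≤-trans (+-monoʳ-≤ 2 (m≤m+n _ _)) (n≤1+n _))

  string-fits : ∀ {x} → x ≤ stringBound n → 3 + x ≤ B
  string-fits x≤ = +-monoʳ-≤ 3 (≤-trans x≤ (≤-trans (m≤m+n _ n) (m≤n+m _ (outputBound n))))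

  spent : List (V × ℕ) → U → ℕ
  spent ps x = sum (map (λ p → proj₂ p * mult (F (proj₁ p)) x) ps)

  Pairs : MultisetRepr k₂ n₂ → List (V × ℕ) → Set
  Pairs = Pointwise (λ e p → Encodes encV (proj₁ e) (proj₁ p) × proj₂ e ≡ proj₂ p)

  -- `fuel` bounds the remaining rounds, and `output-size` reserves room for one entry per round.
  -- `output-done` is what keeps the output free of repetitions: an element already used has
  -- residual 0 at its `τ` and cannot be chosen again.
  record Invariant (fuel : ℕ) (r : MultisetRepr k₁ n₁) (g : U → ℕ)
                   (o : MultisetRepr k₂ n₂) (ps : List (V × ℕ)) : Set where
    field
      residual-listing : Listing r g
      residual-length  : length r ≤ fuel
      residual-size    : size (reprVal r) ≤ n
      output-pairs     : Pairs o ps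
      output-unique    : Unique (map proj₁ ps)
      output-positive  : All (λ p → 0 < proj₂ p) ps
      output-done      : All (λ p → g (τ (proj₁ p)) ≡ 0) ps
      output-size      : size (reprVal o) + fuel * entryBound n ≤ outputBound n
      balance          : ∀ x → g x + spent ps x ≡ mult K x
      still-solvable   : Solvable (mult K) → Solvable g

  state : (io best c F K ok v L : Val) → Store 14
  state io best c F K ok v L =
    io ∷ nil ∷ nil ∷ nil ∷ nil ∷ nil ∷ nil ∷ best ∷ c ∷ F ∷ K ∷ ok ∷ v ∷ L ∷ []

  Final : Store 14 → Set
  Final σ = ∃[ y ] ∃[ σ′ ] Run output σ 2 (y ∷ σ′) × CorrectOutput I y

  final-success : ∀ {fuel g o ps io best c F K v} → Invariant fuel [] g o ps →
                  Final (state io best c F K (bool true) v (reprVal o))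
  final-success {fuel} {g} {o} {ps} inv = _ , _ ,
      run-cond ($io := cons (var $L) nil by
        ≤-trans (≤-reflexive (cong suc (+-comm _ 1)))
                (output-fits (≤-trans (m≤m+n _ (fuel * entryBound n)) output-size))) ,
      inj₁ (o , fromPairs ps output-unique output-positive , refl ,
            represents-fromPairs {E = encV} ps output-unique output-positive output-pairs , solves)
    where
    open Invariant inv
    exhausted : ∀ x → g x ≡ 0
    exhausted x with g x in eq
    ... | zero  = refl
    ... | suc _ with complete residual-listing x (subst (0 <_) (sym eq) (s≤s z≤n))
    ...   | ()
    solves : IsSolution (fromPairs ps output-unique output-positive)
    solves x = trans (cong sum (trans (sym (map-∘ ps)) (map-cong-local
                 (All.map (λ {p} → cong (_* mult (F (proj₁ p)) x)) (count-entries ps output-unique)))))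
               (trans (cong (_+ spent ps x) (sym (exhausted x))) (balance x))

  final-failure : ∀ {io best c F R v L} → ¬ Solvable (mult K) →
                  Final (state io best c F R (bool false) v L)
  final-failure unsolvable = _ , _ , run-cond (set $io nil) ,
    inj₂ (refl , λ (L , sol) → unsolvable (solution⇒solvable {L} sol))

  choose-run : ∀ (e : Str k₁ n₁ × ℕ) r (b : Str k₁ n₁ × ℕ) {io v L k σ′} → length r ≤ n →
    (∀ {io list key found new rest} →
      Run (while (var $todo) minBody)
          (io ∷ nil ∷ list ∷ key ∷ found ∷ reprVal r ∷ new ∷ entryVal e ∷ rest) (loopSteps 5 (length r))
          (io ∷ nil ∷ list ∷ key ∷ found ∷ nil ∷ new ∷ entryVal b ∷ rest)) →
    O triangle (strVal (proj₁ b)) ≡ v → size v ≤ B →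
    Run (cond (var $v) attempt ($K := nil ⨟ $ok := nil))
        (state io (entryVal b) nil nil (reprVal (e ∷ r)) (bool true) v L) k σ′ →
    Run mainBody (state io nil nil nil (reprVal (e ∷ r)) (bool true) nil L)
        (2 + (loopSteps 5 n + (1 + k))) σ′
  choose-run e r b r≤n loop v-ok v≤B next =
    set $best (hd (var $K)) then set $todo (tl (var $K)) then
    relax (loopSteps-mono ≤-refl r≤n) loop then
    ask $v triangle (hd (var $best)) v-ok v≤B then next

  attempt-run : ∀ s m (t : Str k₂ n₂) r f ok {io L k σ′} → length r ≤ n → length f ≤ n →
    O family (strVal t) ≡ reprVal f → size (reprVal f) ≤ B →
    (let c = quotient m (find f s 0)) → fits r c (m ≤ᵇ c * find f s 0) f ≡ ok →
    Run (cond (var $ok) update ($K := nil))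
        (state io (entryVal (s , m)) (num c) (reprVal f) (reprVal r) (bool ok) (cons (strVal t) nil) L) k σ′ →
    Run attempt (state io (entryVal (s , m)) nil nil (reprVal r) (bool true) (cons (strVal t) nil) L)
        (1 + (findSteps n + (5 + (fitsSteps n + k)))) σ′
  attempt-run s m t r f _ r≤n f≤n f-ok f≤B refl next =
    ask $F family (hd (var $v)) f-ok f≤B then
    find-run $F (hd (var $best)) f s f≤n refl refl then
    set $coeff (op quo (tl (var $best)) (var $found)) then
    set $ok (op leq (tl (var $best)) (op mul (var $coeff) (var $found))) then
    set $key nil then set $found nil then set $todo (var $F) then
    relax (loopSteps-mono ≤-refl f≤n) (fits-run r _ f _ r≤n) then next

  update-run : ∀ c f r (t : Str k₂ n₂) o {io best} → length r ≤ n → length f ≤ n → size (reprVal r) ≤ n →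
    size (reprVal ((t , c) ∷ o)) ≤ B →
    Run update (state io best (num c) (reprVal f) (reprVal r) (bool true)
               (cons (strVal t) nil) (reprVal o))
        (updateSteps n)
        (state io nil nil nil (reprVal (subtract c f [] r)) (bool true) nil (reprVal ((t , c) ∷ o)))
  update-run c f r t o r≤n f≤n size≤n o≤B =
    $L := cons (cons (hd (var $v)) (var $coeff)) (var $L) by o≤B then
    set $todo (var $K) then
    relax (loopSteps-mono ≤-refl r≤n)
      (subtract-run r c f [] f≤n (≤-trans (s≤s size≤n) (≤-trans (s≤s (m≤n+m n (2 + (outputBound n + stringBound n))))
        (≤-reflexive (cong (3 +_) (+-assoc (outputBound n) _ _)))))) then
    set $K (var $new) then set $new nil then set $best nil then set $coeff nil then set $F nil then set $v nil

  -- Induction on `fuel`: a successful round drops the entry of the chosen minimum, so the shorter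
  -- residual list fits the smaller fuel; a failed round empties `$K`.
  main-run : ∀ fuel {r g o ps io} → Invariant fuel r g o ps →
    ∃[ σ ] Run (while (var $K) mainBody)
               (state io nil nil nil (reprVal r) (bool true) nil (reprVal o))
               (loopSteps (mainSteps n) fuel) σ
           × Final σ
  main-run fuel {[]} inv =
    _ , relax (1≤loopSteps (mainSteps n) fuel) (run-stop refl) , final-success inv
  main-run zero {_ ∷ _} inv with Invariant.residual-length inv
  ... | ()
  main-run (suc fuel) {e ∷ r} {g} {o} {ps} {io} inv
    with residual-listing
    where open Invariant inv
  ... | lr@(listing ((u₀ , enc₀ , eq₀ , 0<g₀) ∷ es) covered)
    with min-run r e enc₀ eq₀ 0<g₀ es
  ... | b@(s , m) , u , enc , m≡ , 0<gu , u≼u₀ , least , loop = go (triangle-ok s u enc)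
    where
    open Invariant inv

    er≤n : length (e ∷ r) ≤ n
    er≤n = ≤-trans (length-size entryVal (e ∷ r)) residual-size

    r≤n : length r ≤ n
    r≤n = ≤-trans (n≤1+n _) er≤n

    minimum : ∀ w → 0 < g w → u ≼ w
    minimum w 0<gw = All.lookupWith (λ below enc-w → below w enc-w)
      ((λ x enc-x → subst (u ≼_) (decode-unique enc₀ enc-x) u≼u₀) ∷ least) (covered w 0<gw)

    Goal : Set
    Goal = ∃[ σ ] Run (while (var $K) mainBody)
                      (state io nil nil nil (reprVal (e ∷ r)) (bool true) nil (reprVal o))
                      (loopSteps (mainSteps n) (suc fuel)) σ
                  × Final σ

    stop : ∀ {best c F v L} → ¬ Solvable g →
      Run mainBody (state io nil nil nil (reprVal (e ∷ r)) (bool true) nil (reprVal o))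
          (mainSteps n) (state io best c F nil (bool false) v L) → Goal
    stop unsolvable body =
      _ , run-loop refl body (relax (1≤loopSteps (mainSteps n) fuel) (run-stop refl)) ,
      final-failure (λ sol → unsolvable (still-solvable sol))

    found : ∀ t v f → O triangle (strVal s) ≡ cons (strVal t) nil → Encodes encV t v → τ v ≡ u →
            O family (strVal t) ≡ reprVal f → Represents encU f (F v) → Goal
    -- Splits on the final value of the flag, which conjoins exact divisibility with the pointwise
    -- inequality.
    found t v f t-ok enc-t τv≡u f-ok rep = decide _ refl
      where
      lf : Listing f (mult (F v))
      lf = represents⇒listing {L = F v} rep
      q = find f s 0
      c = quotient m q
      q≡ : q ≡ mult (F v) u
      q≡ = find-listing lf enc

      f-size : size (reprVal f) ≤ n
      f-size = ≤-trans (≤-trans (≤-reflexive (cong size (sym f-ok))) (family-length t v enc-t)) (m≤n+m M _)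

      f≤n : length f ≤ n
      f≤n = ≤-trans (length-size entryVal f) f-size

      body : ∀ ok {σ} → fits (e ∷ r) c (m ≤ᵇ c * q) f ≡ ok →
             Run (cond (var $ok) update ($K := nil))
                 (state io (entryVal b) (num c) (reprVal f) (reprVal (e ∷ r)) (bool ok)
                   (cons (strVal t) nil) (reprVal o))
                 (1 + updateSteps n) σ →
             Run mainBody (state io nil nil nil (reprVal (e ∷ r)) (bool true) nil (reprVal o)) (mainSteps n) σ
      body ok eq next = choose-run e r b r≤n loop t-ok
        (≤-trans (≤-reflexive (cong suc (+-comm _ 1))) (≤-trans (n≤1+n _) (string-fits (V-string-size t))))
        (run-cond (attempt-run s m t (e ∷ r) f ok er≤n f≤n f-ok (≤-trans f-size n≤B) eq next))

      decide : ∀ ok → fits (e ∷ r) c (m ≤ᵇ c * q) f ≡ ok → Goal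
      decide false eq = stop unsolvable
        (body false eq (relax (s≤s (s≤s z≤n)) (run-cond (set $K nil))))
        where
        unsolvable : ¬ Solvable g
        unsolvable sol with forced-quotient sol 0<gu minimum τv≡u m≡ q≡
        ... | m≤cq , cF≤g , _ = contradiction
          (trans (sym eq) (trans (cong (λ ok → fits (e ∷ r) c ok f) (Equivalence.to T-≡ (≤⇒≤ᵇ m≤cq)))
            (fits-complete (e ∷ r) c f (≤⇒fits c (entries lf) lr cF≤g)))) λ ()
      decide true eq =
        let σ , loops , final = main-run fuel next in
        σ , run-loop refl
              (body true eq (run-cond (update-run c f (e ∷ r) t o er≤n f≤n residual-size
                (≤-trans (m≤n+m _ 2) (output-fits (m+n≤o⇒m≤o _ (Invariant.output-size next)))))))
              loops , final
        where
        accepted = fits-sound (e ∷ r) c (m ≤ᵇ c * q) f eq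
        m≤cq : m ≤ c * q
        m≤cq = ≤ᵇ⇒≤ _ _ (Equivalence.from T-≡ (proj₁ accepted))
        cF≤g : ∀ x → c * mult (F v) x ≤ g x
        cF≤g = fits⇒≤ c lf lr (proj₂ accepted)
        g′ : U → ℕ
        g′ x = g x ∸ c * mult (F v) x
        g′u≡0 : g′ u ≡ 0
        g′u≡0 = m≤n⇒m∸n≡0 (subst₂ (λ x y → x ≤ c * y) m≡ q≡ m≤cq)
        vanish : ∀ {x} → g x ≡ 0 → g′ x ≡ 0
        vanish {x} gx≡0 = trans (cong (_∸ c * mult (F v) x) gx≡0) (0∸n≡0 (c * mult (F v) x))
        c≤m : c ≤ m
        c≤m = quotient≤ m q
        entry-size : 2 + (size (strVal t) + size (num c)) ≤ entryBound n
        entry-size = +-monoʳ-≤ 2 (+-mono-≤ (V-string-size t)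
          (≤-trans (size-num-mono (≤-trans c≤m (≤-reflexive m≡)))
            (≤-trans (value-size (entries lr) (covered u 0<gu)) residual-size)))
        next : Invariant fuel (subtract c f [] (e ∷ r)) g′ ((t , c) ∷ o) ((v , c) ∷ ps)
        next = record
          { residual-listing = subtract-listing lf lr
          ; residual-length  = s≤s⁻¹
              (≤-trans (subtract-shrinks lf [] (entries lr) g′u≡0 (covered u 0<gu)) residual-length)
          ; residual-size    = ≤-trans
              (s≤s⁻¹ (≤-trans (≤-reflexive (+-comm 1 _)) (subtract-size c f [] (e ∷ r)))) residual-size
          ; output-pairs     = (enc-t , refl) ∷ output-pairs
          ; output-unique    = All.map⁺ (All.map (λ {p} → fresh {p}) output-done) ∷ output-unique
          -- The positive `m` is at most `c * q`, so `c` cannot be 0.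
          ; output-positive  = proj₁ (factors-positive c q (<-≤-trans (subst (0 <_) (sym m≡) 0<gu) m≤cq))
                               ∷ output-positive
          ; output-done      = trans (cong g′ τv≡u) g′u≡0 ∷ All.map vanish output-done
          ; output-size      = ≤-trans (≤-trans
              (≤-reflexive (trans (cong (_+ fuel * entryBound n) (+-comm _ (size (reprVal o))))
                                  (+-assoc (size (reprVal o)) _ _)))
              (+-monoʳ-≤ (size (reprVal o)) (+-monoˡ-≤ (fuel * entryBound n) entry-size))) output-size
          ; balance          = λ x → trans (sym (+-assoc (g′ x) _ _))
              (trans (cong (_+ spent ps x) (m∸n+n≡m (cF≤g x))) (balance x))
          ; still-solvable   = λ sol → proj₂ (proj₂
              (forced-quotient (still-solvable sol) 0<gu minimum τv≡u m≡ q≡))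
          }
          where
          fresh : ∀ {p : V × ℕ} → g (τ (proj₁ p)) ≡ 0 → v ≢ proj₁ p
          fresh g≡0 refl = contradiction (subst (0 <_) (trans (cong g (sym τv≡u)) g≡0) 0<gu) λ ()

    go : _ → Goal
    go (inj₂ (error , none)) = stop
      (λ sol → let v , τv≡u , _ = forced sol 0<gu minimum in none (v , τv≡u))
      (choose-run e r b r≤n loop error (s≤s z≤n) (relax (s≤s (s≤s (s≤s z≤n))) (run-cond (set $K nil then set $ok nil))))
    go (inj₁ (t , v , t-ok , enc-t , τv≡u)) =
      let f , f-ok , rep = family-ok t v enc-t in found t v f t-ok enc-t τv≡u f-ok rep

  -- Starting with fuel `n` makes the reserved output space equal to `outputBound n` by definition:
  -- the leading 1 is the empty output.
  initial : Invariant n K-repr (mult K) [] []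
  initial = record
    { residual-listing = represents⇒listing {L = K} K-repr-ok
    ; residual-length  = ≤-trans (length-size entryVal K-repr) K-size
    ; residual-size    = K-size
    ; output-pairs     = []
    ; output-unique    = []
    ; output-positive  = []
    ; output-done      = []
    ; output-size      = ≤-refl
    ; balance          = λ x → +-identityʳ _
    ; still-solvable   = id
    }
    where
    K-size : size (reprVal K-repr) ≤ n
    K-size = component-size (there (there (there (there (here refl)))))

  program-solves : ∃[ y ] ∃[ t ] HaltsWith O program (inputVal I) y t × t ≤ timeBound n × CorrectOutput I y
  program-solves =
    let _ , loops , y , _ , out , correct = main-run n initial
        _ , t , D , t≤ = execute
          (set $ok (cons nil nil) then set $K (hd (tl (tl (tl (tl (var $io)))))) then loops then out)
          (≤-trans (m≤m+n _ M) n≤B ∷ 1≤B ∷ 1≤B ∷ 1≤B ∷ 1≤B ∷ 1≤B ∷ 1≤B ∷ 1≤B ∷ 1≤B ∷ 1≤B ∷ 1≤B ∷ 1≤B ∷ 1≤B ∷ 1≤B ∷ [])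
    in y , t , (_ , D , refl) , t≤ , correct
    where
    1≤B : 1 ≤ B
    1≤B = s≤s z≤n

-- Polynomiality of the time bound

loopSteps-poly : ∀ {f g} → PolyBounded f → PolyBounded g → PolyBounded (λ n → loopSteps (f n) (g n))
loopSteps-poly {f} {g} p q =
  let c , d , bound = +-poly (const-poly 1) (*-poly q (+-poly (const-poly 1) p)) in
  c , d , λ n → subst (_≤ c * suc n ^ d) (sym (loopSteps-closed (f n) (g n))) (bound n)

timeBound-poly : PolyBounded timeBound
timeBound-poly = *-poly total-poly (*-poly (const-poly 100) register-poly)
  where
  find-poly : PolyBounded findSteps
  find-poly = +-poly (const-poly 3) (loopSteps-poly (const-poly 5) id-poly)
  fits-poly : PolyBounded fitsSteps
  fits-poly = loopSteps-poly (+-poly find-poly (const-poly 5)) id-poly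
  subtract-poly : PolyBounded subtractSteps
  subtract-poly = loopSteps-poly (+-poly find-poly (const-poly 6)) id-poly
  update-poly : PolyBounded updateSteps
  update-poly = +-poly (const-poly 2) (+-poly subtract-poly (const-poly 6))
  attempt-poly : PolyBounded attemptSteps
  attempt-poly = +-poly (const-poly 1) (+-poly find-poly (+-poly (const-poly 5)
                   (+-poly fits-poly (+-poly (const-poly 1) update-poly))))
  main-poly : PolyBounded mainSteps
  main-poly = +-poly (const-poly 2) (+-poly (loopSteps-poly (const-poly 5) id-poly)
                (+-poly (const-poly 2) attempt-poly))
  total-poly : PolyBounded totalSteps
  total-poly = +-poly (const-poly 2) (+-poly (loopSteps-poly main-poly id-poly) (const-poly 2))
  string-poly : PolyBounded stringBound
  string-poly = +-poly (const-poly 1) (*-poly id-poly (+-poly (const-poly 1) id-poly))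
  entry-poly : PolyBounded entryBound
  entry-poly = +-poly (const-poly 2) (+-poly string-poly id-poly)
  output-poly : PolyBounded outputBound
  output-poly = +-poly (const-poly 1) (*-poly id-poly entry-poly)
  register-poly : PolyBounded registerBound
  register-poly = +-poly (const-poly 3) (+-poly output-poly (+-poly string-poly id-poly))

proposition1p14 : ∃[ P ] ∃[ c ] ∃[ d ]
    ((I : Instance) (O : Oracle) → Answers I O →
    (M : ℕ) → FamilyLength≤ I O M →
    ∃[ y ] ∃[ t ]
    HaltsWith O P (inputVal I) y t
    × t ≤ c * (size (inputVal I) + M) ^ d + c
    × CorrectOutput I y)
proposition1p14 = package (poly-monomial timeBound-poly)
  where
  package : ∃[ c ] ∃[ d ] (∀ n → 1 ≤ n → timeBound n ≤ c * n ^ d + c) → _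
  package (c , d , bound) = program , c , d , λ I O answers M family-length →
    let y , t , halts , t≤ , correct = Main.program-solves I O answers M family-length in
    y , t , halts ,
    -- `M` may be 0, but the input value always has positive size, as the passage to a monomial
    -- requires.
    ≤-trans t≤ (bound (size (inputVal I) + M) (≤-trans (1≤size (inputVal I)) (m≤m+n _ M))) , correct
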